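{- Let $Q$ be a positive integer, let $x$ be the least common multiple of $1,2,\dots,Q$, and let $Y=(Y_{mn})_{m,n=1}^x$ be the $x\times x$ matrix with $Y_{mn}=\sum_{q=1}^Q S(m,n;q)$. Then the characteristic polynomial of $Y$ is \[ \det(\lambda E_x-Y)=\lambda^{x-\Phi(Q)}(\lambda-x)^{\frac{\Phi(Q)+\widetilde{\Phi}(Q)}{2}}(\lambda+x)^{\frac{\Phi(Q)-\widetilde{\Phi}(Q)}{2}}. \] In particular, $Y$ has eigenvalues $0,x,-x$ with multiplicities $x-\Phi(Q)$, $\frac{\Phi(Q)+\widetilde{\Phi}(Q)}{2}$, $\frac{\Phi(Q)-\widetilde{\Phi}(Q)}{2}$, respectively.
   Context: For positive integer $q$ and integers $m,n$, the Kloosterman sum is $S(m,n;q)=\sum_{1\le k\le q,\ \gcd(k,q)=1}\exp\bigl(\frac{2\pi i}{q}(mk+nk^*)\bigr)$, where $k^*$ denotes an inverse of $k$ modulo $q$. $\varphi$ is Euler's totient function and $\Phi(Q)=\sum_{q=1}^Q\varphi(q)$. Let $\widetilde{\varphi}(q)=\#\{1\le k\le q:\ \gcd(k,q)=1,\ k+k^*\equiv 0\pmod q\}$ and $\widetilde{\Phi}(Q)=\sum_{q=1}^Q\widetilde{\varphi}(q)$. $E_x$ is the $x\times x$ identity matrix. -}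

module Defs where

open import Level using (Level)
open import Data.Nat using (ℕ; zero; suc; _+_; _*_; _∸_; _%_; _/_; _≡ᵇ_)
open import Data.Nat.GCD using (gcd)
open import Data.Nat.LCM using (lcm)
open import Data.Bool using (Bool; true; false; if_then_else_; _∧_)
open import Data.Fin using (Fin; zero; suc; toℕ; punchIn)
open import Algebra.Bundles using (CommutativeRing)
import Data.Nat as N

lcmUpTo : ℕ → ℕ
lcmUpTo zero    = 1
lcmUpTo (suc n) = lcm (suc n) (lcmUpTo n)

countUpTo : ℕ → (ℕ → Bool) → ℕ
countUpTo zero    P = 0
countUpTo (suc n) P = (if P (suc n) then 1 else 0) + countUpTo n P

sumℕ : ℕ → (ℕ → ℕ) → ℕ
sumℕ zero    f = 0
sumℕ (suc n) f = f (suc n) + sumℕ n f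

-- An inverse k* of k modulo q (q = suc p): the largest l ∈ {1,…,q}
-- with k·l ≡ 1 (mod q); it is 0 if none exists (never used then,
-- since we only apply it to k coprime to q).
invSearch : (p k j : ℕ) → ℕ
invSearch p k zero    = 0
invSearch p k (suc j) =
  if ((k * suc j) % suc p) ≡ᵇ (1 % suc p) then suc j else invSearch p k j

inv : (p k : ℕ) → ℕ
inv p k = invSearch p k (suc p)

coprimeᵇ : ℕ → ℕ → Bool
coprimeᵇ k q = gcd k q ≡ᵇ 1

φ : ℕ → ℕ
φ q = countUpTo q (λ k → coprimeᵇ k q)

Φ : ℕ → ℕ
Φ Q = sumℕ Q φ

φ̃ : ℕ → ℕ
φ̃ zero    = 0
φ̃ (suc p) = countUpTo (suc p)
  (λ k → coprimeᵇ k (suc p) ∧ (((k + inv p k) % suc p) ≡ᵇ 0))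

Φ̃ : ℕ → ℕ
Φ̃ Q = sumℕ Q φ̃

module RingDefs {c ℓ : Level} (R : CommutativeRing c ℓ) where
  open CommutativeRing R using (Carrier; 0#; 1#; -_) renaming (_+_ to _+ᴿ_; _*_ to _*ᴿ_)

  pow : Carrier → ℕ → Carrier
  pow a zero    = 1#
  pow a (suc n) = a *ᴿ pow a n

  fromℕ : ℕ → Carrier
  fromℕ zero    = 0#
  fromℕ (suc n) = 1# +ᴿ fromℕ n

  sumR : ℕ → (ℕ → Carrier) → Carrier
  sumR zero    f = 0#
  sumR (suc n) f = f (suc n) +ᴿ sumR n f

  sumFin : (n : ℕ) → (Fin n → Carrier) → Carrier
  sumFin zero    f = 0#
  sumFin (suc n) f = f zero +ᴿ sumFin n (λ j → f (suc j))

  sign : ℕ → Carrier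
  sign j = pow (- 1#) j

  det : (n : ℕ) → (Fin n → Fin n → Carrier) → Carrier
  det zero    M = 1#
  det (suc n) M = sumFin (suc n) (λ j →
    sign (toℕ j) *ᴿ (M zero j *ᴿ det n (λ a b → M (suc a) (punchIn j b))))

  idMat : (n : ℕ) → Fin n → Fin n → Carrier
  idMat n i j with toℕ i ≡ᵇ toℕ j
  ... | true  = 1#
  ... | false = 0#

  -- Kloosterman sum S(m,n;q) for q = suc p, where ζ is a primitive
  -- x-th root of unity with (suc p) ∣ x, so that
  -- exp(2πi a / q) is realised as ζ^((x / q) · a).
  kloosterman : (ζ : Carrier) (x : ℕ) (m n p : ℕ) → Carrier
  kloosterman ζ x m n p =
    sumR (suc p) (λ k →
      if coprimeᵇ k (suc p)
      then pow ζ ((x / suc p) * (m * k + n * inv p k))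
      else 0#)

  Ymat : (ζ : Carrier) (Q x : ℕ) → Fin x → Fin x → Carrier
  Ymat ζ Q x i j =
    sumR Q (λ q → kloosterman ζ x (suc (toℕ i)) (suc (toℕ j)) (q ∸ 1))

{-# OPTIONS --safe #-}
module Submission where

-- Let F be the Fourier matrix (ζ^{ij}), whose determinant is non-zero because F · F⁻ = x E and x ≠ 0 in R.
-- Every exponent e ≤ x is a fraction e/x = k/q in lowest terms; write τ e = (x/q) l with l ≡ −k* (mod q)
-- when q ≤ Q, and τ e = e otherwise. Summing the exponentials over the column index first gives
-- (Y F)_{ie} = x F_{i,τ e} for q ≤ Q and 0 otherwise, so Y is conjugate to x times the permutation matrix
-- of the involution τ restricted to the Φ(Q) Farey exponents. A fixed point contributes t − x, a two-cycle
-- (t − x)(t + x) and every other exponent t; the fixed points are counted by Φ̃(Q).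

open import Defs

-- Arithmetic of the Farey fractions

-- The coefficients lie in an arbitrary integral domain containing an element `ζ` of exact order
-- `x`. Its characteristic is not prescribed, so `x ≠ 0` in it has to be derived from the order of
-- `ζ`, and no inverse of the Fourier matrix is at hand. Hence only determinants are compared:
-- `(tE - Y) F = F T` gives `det (tE - Y) * det F = det F * det T`, and the non-zero factor `det F`
-- is cancelled. Multiplicativity must be extracted from the Laplace expansion, by showing that a
-- multilinear alternating function of the rows is determined by its value at the identity. The sign
-- in `l ≡ -k*` comes from orthogonality: with `g = x / q`, the sum over `n` of the powers of `ζ`
-- with exponent `n (g k* + a)` survives only if `x` divides `g k* + a`. Rewritten as
-- `k l ≡ -1 (mod q)`, the condition is symmetric, which makes the pairing an involution. Exponents
-- run through 1,...,x, like the indices of `Y`, so residue 0 appears as the fraction 1/1 and every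
-- range of residues below is 1,...,q.

module Arithmetic where
  open import Data.Nat
  open import Data.Nat.Properties
  open import Data.Nat.Divisibility
  open import Data.Nat.DivMod
  open import Data.Nat.GCD using (gcd; gcd[m,n]∣m; gcd[m,n]∣n; gcd[m,n]≢0; c*gcd[m,n]≡gcd[cm,cn]; module Bézout)
  open import Data.Nat.LCM using (m∣lcm[m,n]; n∣lcm[m,n]; gcd*lcm)
  open import Data.Nat.Coprimality using (Coprime; gcd≡1⇒coprime; coprime-Bézout; coprime-divisor)
  import Data.Nat.Coprimality as Coprimality
  open import Data.Nat.Solver using (module +-*-Solver)
  open import Data.Bool using (Bool; true; false; if_then_else_; _∧_; T)
  open import Data.Bool.Properties using (∧-identityʳ; ∧-zeroʳ)
  open import Data.Empty using (⊥-elim)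
  open import Data.Product using (∃; _×_; _,_; proj₁; proj₂)
  open import Data.Sum using (_⊎_; inj₁; inj₂)
  open import Relation.Nullary using (¬_; yes; no)
  open import Relation.Nullary.Decidable using (dec-true; dec-false)
  open import Relation.Binary.PropositionalEquality

  lcmUpTo≢0 : ∀ n → lcmUpTo n ≢ 0
  lcmUpTo≢0 (suc n) eq with m*n≡0⇒m≡0∨n≡0 (suc n) (trans (sym (gcd*lcm (suc n) (lcmUpTo n)))
    (trans (cong (gcd (suc n) (lcmUpTo n) *_) eq) (*-zeroʳ (gcd (suc n) (lcmUpTo n)))))
  ... | inj₂ l≡0 = lcmUpTo≢0 n l≡0

  ∣lcmUpTo : ∀ n q → 1 ≤ q → q ≤ n → q ∣ lcmUpTo n
  ∣lcmUpTo zero    q 1≤q q≤0 = ⊥-elim (<⇒≱ 1≤q q≤0)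
  ∣lcmUpTo (suc n) q 1≤q q≤n with m≤n⇒m<n∨m≡n q≤n
  ... | inj₁ q<1+n = ∣-trans (∣lcmUpTo n q 1≤q (s≤s⁻¹ q<1+n)) (n∣lcm[m,n] (suc n) (lcmUpTo n))
  ... | inj₂ refl  = m∣lcm[m,n] (suc n) (lcmUpTo n)

  %-congˡ-+ : ∀ {a b} c q .{{_ : NonZero q}} → a % q ≡ b % q → (a + c) % q ≡ (b + c) % q
  %-congˡ-+ {a} {b} c q a≡b = trans (%-distribˡ-+ a c q)
    (trans (cong (λ r → (r + c % q) % q) a≡b) (sym (%-distribˡ-+ b c q)))

  -- Inverses and negative inverses modulo q

  module _ (p : ℕ) where
    private q = suc p

    infix 4 _≡1/_
    _≡1/_ : ℕ → ℕ → Set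
    i ≡1/ k = (k * i) % q ≡ 1 % q

    inverse-exists : ∀ k → Coprime k q → ∃ λ i → i ≡1/ k
    inverse-exists k k⊥q with coprime-Bézout k⊥q
    ... | Bézout.+- x y eq = x , trans (cong (_% q) (trans (*-comm k x) (sym eq))) ([m+kn]%n≡m%n 1 y q)
    -- Here `x * k ≡ -1`, so the inverse is `-x`; the natural number `x * p` represents it because
    -- `p ≡ -1 (mod q)`.
    ... | Bézout.-+ x y eq = x * p , (begin
      (k * (x * p)) % q                  ≡⟨ sym ([m+kn]%n≡m%n (k * (x * p)) y q) ⟩
      (k * (x * p) + y * q) % q          ≡⟨ cong (λ r → (k * (x * p) + r) % q) (sym eq) ⟩
      (k * (x * p) + (1 + x * k)) % q    ≡⟨ cong (_% q) (solve 3 (λ k x p → k :* (x :* p) :+ (con 1 :+ x :* k) := con 1 :+ (k :* x) :* (con 1 :+ p))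
            refl k x p) ⟩
      (1 + (k * x) * q) % q              ≡⟨ [m+kn]%n≡m%n 1 (k * x) q ⟩
      1 % q                              ∎)
      where
      open ≡-Reasoning
      open +-*-Solver

    reduced-inverse : ∀ k i → i ≡1/ k → ∃ λ j → suc j ≤ q × suc j ≡1/ k
    -- Adding `p` before the reduction and 1 after it selects the representative of `i` in 1,...,q,
    -- the range of the search; for `q = 1` it is 1 and not 0.
    reduced-inverse k i ki≡1 = (i + p) % q , m%n<n (i + p) q , (begin
      (k * suc ((i + p) % q)) % q                 ≡⟨ %-distribˡ-* k _ q ⟩
      ((k % q) * (suc ((i + p) % q) % q)) % q     ≡⟨ cong (λ r → ((k % q) * r) % q) mod ⟩
      ((k % q) * (i % q)) % q                     ≡⟨ sym (%-distribˡ-* k i q) ⟩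
      (k * i) % q                                 ≡⟨ ki≡1 ⟩
      1 % q                                       ∎)
      where
      open ≡-Reasoning
      mod : suc ((i + p) % q) % q ≡ i % q
      mod = begin
        suc ((i + p) % q) % q  ≡⟨ cong (_% q) (+-comm 1 ((i + p) % q)) ⟩
        ((i + p) % q + 1) % q  ≡⟨ %-congˡ-+ {(i + p) % q} {i + p} 1 q (m%n%n≡m%n (i + p) q) ⟩
        (i + p + 1) % q        ≡⟨ cong (_% q) (trans (+-assoc i p 1) (cong (i +_) (+-comm p 1))) ⟩
        (i + q) % q            ≡⟨ [m+n]%n≡m%n i q ⟩
        i % q                  ∎

    -- The search runs downwards from `n`, so it either stops at a larger solution or reaches
    -- `suc j`.
    invSearch-found : ∀ k n j → suc j ≤ n → suc j ≡1/ k →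
      invSearch p k n ≡1/ k × 1 ≤ invSearch p k n × invSearch p k n ≤ n
    invSearch-found k (suc n) j j<n kj≡1 with ((k * suc n) % q) ≡ᵇ (1 % q) in eq
    ... | true  = ≡ᵇ⇒≡ _ _ (subst T (sym eq) _) , s≤s z≤n , ≤-refl
    ... | false with m≤n⇒m<n∨m≡n j<n
    ...   | inj₂ refl = ⊥-elim (subst T eq (≡⇒≡ᵇ _ _ kj≡1))
    ...   | inj₁ j<n′ with invSearch-found k n j (s≤s⁻¹ j<n′) kj≡1
    ...     | e , 1≤ , ≤n = e , 1≤ , m≤n⇒m≤1+n ≤n

    inv-spec : ∀ k → gcd k q ≡ 1 → inv p k ≡1/ k × 1 ≤ inv p k × inv p k ≤ q
    inv-spec k k⊥q =
      let i , ki≡1 = inverse-exists k (gcd≡1⇒coprime k⊥q)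
          j , j<q , kj≡1 = reduced-inverse k i ki≡1
      in invSearch-found k q j j<q kj≡1

    -- Links two forms of `m ≡ -k*`: the divisibility `q ∣ i + m` is what exponential sums produce,
    -- while `q ∣ suc (k * m)` is symmetric in `k` and `m`.
    inverse-shift : ∀ k i m → i ≡1/ k → (k * (i + m)) % q ≡ suc (k * m) % q
    inverse-shift k i m ki≡1 = trans (cong (_% q) (*-distribˡ-+ k i m)) (%-congˡ-+ {k * i} {1} (k * m) q ki≡1)

    ∣inv+⇒∣suc* : ∀ k i m → i ≡1/ k → q ∣ i + m → q ∣ suc (k * m)
    ∣inv+⇒∣suc* k i m ki≡1 q∣ = m%n≡0⇒n∣m _ q
      (trans (sym (inverse-shift k i m ki≡1)) (n∣m⇒m%n≡0 _ q (∣n⇒∣m*n k q∣)))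

    ∣suc*⇒∣inv+ : ∀ k i m → gcd k q ≡ 1 → i ≡1/ k → q ∣ suc (k * m) → q ∣ i + m
    ∣suc*⇒∣inv+ k i m k⊥q ki≡1 q∣ = coprime-divisor {n = k} (Coprimality.sym (gcd≡1⇒coprime {k} k⊥q))
      (m%n≡0⇒n∣m _ q (trans (inverse-shift k i m ki≡1) (n∣m⇒m%n≡0 _ q q∣)))

    -- The representative of `-k*` in 1,...,q. The inverse is reduced before the subtraction because
    -- for `q = 1` it equals `q`, and the result must be 1 rather than 0.
    negInv : ℕ → ℕ
    negInv k = q ∸ inv p k % q

    negInv-spec : ∀ k → gcd k q ≡ 1 → q ∣ suc (k * negInv k)
    negInv-spec k k⊥q = ∣inv+⇒∣suc* k i (negInv k) (proj₁ (inv-spec k k⊥q))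
      (divides (suc (i / q)) (begin
        i + (q ∸ i % q)                   ≡⟨ cong (_+ (q ∸ i % q)) (m≡m%n+[m/n]*n i q) ⟩
        i % q + i / q * q + (q ∸ i % q)   ≡⟨ cong (_+ (q ∸ i % q)) (+-comm (i % q) _) ⟩
        i / q * q + i % q + (q ∸ i % q)   ≡⟨ +-assoc (i / q * q) _ _ ⟩
        i / q * q + (i % q + (q ∸ i % q)) ≡⟨ cong (i / q * q +_) (m+[n∸m]≡n (m%n≤n i q)) ⟩
        i / q * q + q                     ≡⟨ +-comm _ q ⟩
        suc (i / q) * q                   ∎))
      where
      open ≡-Reasoning
      i = inv p k

    1≤negInv : ∀ k → 1 ≤ negInv k
    1≤negInv k = m<n⇒0<n∸m (m%n<n (inv p k) q)

    negInv≤ : ∀ k → negInv k ≤ q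
    negInv≤ k = m∸n≤m q (inv p k % q)

  -- A common divisor of `k` and `q` divides both `k * l` and its successor. Thus the condition
  -- `q ∣ suc (k * l)` by itself puts both fractions of a partner pair in lowest terms.
  ∣suc*⇒coprime : ∀ {q} k l → q ∣ suc (k * l) → gcd k q ≡ 1
  ∣suc*⇒coprime {q} k l q∣ = ∣1⇒≡1 (∣m+n∣m⇒∣n
    (subst (gcd k q ∣_) (+-comm 1 (k * l)) (∣-trans (gcd[m,n]∣n k q) q∣)) (∣m⇒∣m*n l (gcd[m,n]∣m k q)))

  -- Subtracting the two conditions shows that `q` divides `k * (l′ ∸ l)`, hence `l′ ∸ l`; but
  -- `1 ≤ l` and `l′ ≤ q` make this difference smaller than `q`.
  negInverse-unique≤ : ∀ {q} k {l l′} → q ∣ suc (k * l) → q ∣ suc (k * l′) →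
    1 ≤ l → l ≤ l′ → l′ ≤ q → l ≡ l′
  negInverse-unique≤ {q} k {l} {l′} q∣ q∣′ 1≤l l≤l′ l′≤q with l′ ∸ l in eq
  ... | zero  = ≤-antisym l≤l′ (m∸n≡0⇒m≤n eq)
  ... | suc d = ⊥-elim (<⇒≱ (<-≤-trans (∸-monoʳ-< {l′} {l} {0} 1≤l l≤l′) l′≤q) (∣⇒≤ {{ subst NonZero (sym eq) _ }} q∣d))
    where
    q∣d : q ∣ l′ ∸ l
    q∣d = coprime-divisor {n = k} (Coprimality.sym (gcd≡1⇒coprime {k} (∣suc*⇒coprime k l q∣)))
      (∣m+n∣m⇒∣n (subst (q ∣_) (cong suc (trans (cong (k *_) (sym (m+[n∸m]≡n l≤l′))) (*-distribˡ-+ k l (l′ ∸ l)))) q∣′) q∣)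

  negInverse-unique : ∀ {q} k {l l′} → q ∣ suc (k * l) → q ∣ suc (k * l′) →
    1 ≤ l → l ≤ q → 1 ≤ l′ → l′ ≤ q → l ≡ l′
  negInverse-unique k {l} {l′} q∣ q∣′ 1≤l l≤q 1≤l′ l′≤q with ≤-total l l′
  ... | inj₁ l≤l′ = negInverse-unique≤ k q∣ q∣′ 1≤l l≤l′ l′≤q
  ... | inj₂ l′≤l = sym (negInverse-unique≤ k q∣′ q∣ 1≤l′ l′≤l l≤q)

  gcd-scaled : ∀ g k q → gcd k q ≡ 1 → gcd (g * k) (g * q) ≡ g
  gcd-scaled g k q k⊥q = trans (sym (c*gcd[m,n]≡gcd[cm,cn] g k q)) (trans (cong (g *_) k⊥q) (*-identityʳ g))

  -- Counting by blocks and by fibres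

  countUpTo-cong : ∀ n {P P′ : ℕ → Bool} → (∀ k → 1 ≤ k → k ≤ n → P k ≡ P′ k) → countUpTo n P ≡ countUpTo n P′
  countUpTo-cong zero    P≡P′ = refl
  countUpTo-cong (suc n) P≡P′ = cong₂ (λ b m → (if b then 1 else 0) + m) (P≡P′ (suc n) (s≤s z≤n) ≤-refl)
    (countUpTo-cong n (λ k 1≤k k≤n → P≡P′ k 1≤k (m≤n⇒m≤1+n k≤n)))

  countUpTo-false : ∀ n {P : ℕ → Bool} → (∀ k → 1 ≤ k → k ≤ n → P k ≡ false) → countUpTo n P ≡ 0
  countUpTo-false zero    P≡false = refl
  countUpTo-false (suc n) P≡false = cong₂ (λ b m → (if b then 1 else 0) + m) (P≡false (suc n) (s≤s z≤n) ≤-refl)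
    (countUpTo-false n (λ k 1≤k k≤n → P≡false k 1≤k (m≤n⇒m≤1+n k≤n)))

  countUpTo-+ : ∀ m n P → countUpTo (m + n) P ≡ countUpTo m (λ k → P (k + n)) + countUpTo n P
  countUpTo-+ zero    n P = refl
  countUpTo-+ (suc m) n P = trans (cong ((if P (suc m + n) then 1 else 0) +_) (countUpTo-+ m n P))
    (sym (+-assoc (if P (suc m + n) then 1 else 0) _ _))

  -- The range splits into `q` blocks of length `g`, and only the last number of each block is a
  -- multiple of `g`.
  countUpTo-multiples : ∀ q g .{{_ : NonZero g}} P → (∀ a → P a ≡ true → g ∣ a) →
    countUpTo (q * g) P ≡ countUpTo q (λ k → P (k * g))
  countUpTo-multiples zero    g P P⇒∣ = refl
  countUpTo-multiples (suc q) g@(suc g′) P P⇒∣ = trans (countUpTo-+ g (q * g) P)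
    (cong₂ _+_
      (trans (cong ((if P (g + q * g) then 1 else 0) +_) (countUpTo-false g′ nonmultiple)) (+-identityʳ _))
      (countUpTo-multiples q g P P⇒∣))
    where
    nonmultiple : ∀ k → 1 ≤ k → k ≤ g′ → P (k + q * g) ≡ false
    nonmultiple k 1≤k k≤g′ with P (k + q * g) in eq
    ... | false = refl
    ... | true  = ⊥-elim (<⇒≱ (s≤s k≤g′) (∣⇒≤ {{>-nonZero 1≤k}}
      (∣m+n∣m⇒∣n (subst (g ∣_) (+-comm k (q * g)) (P⇒∣ _ eq)) (divides q refl))))

  sumℕ-cong : ∀ n {f f′ : ℕ → ℕ} → (∀ k → 1 ≤ k → k ≤ n → f k ≡ f′ k) → sumℕ n f ≡ sumℕ n f′
  sumℕ-cong zero    f≡f′ = refl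
  sumℕ-cong (suc n) f≡f′ = cong₂ _+_ (f≡f′ (suc n) (s≤s z≤n) ≤-refl)
    (sumℕ-cong n (λ k 1≤k k≤n → f≡f′ k 1≤k (m≤n⇒m≤1+n k≤n)))

  sumℕ-+ : ∀ n (f f′ : ℕ → ℕ) → sumℕ n (λ k → f k + f′ k) ≡ sumℕ n f + sumℕ n f′
  sumℕ-+ zero    f f′ = refl
  sumℕ-+ (suc n) f f′ = trans (cong (f (suc n) + f′ (suc n) +_) (sumℕ-+ n f f′))
    (solve 4 (λ a b c d → (a :+ b) :+ (c :+ d) := (a :+ c) :+ (b :+ d)) refl (f (suc n)) (f′ (suc n)) (sumℕ n f) (sumℕ n f′))
    where open +-*-Solver

  sumℕ-zero : ∀ n {f : ℕ → ℕ} → (∀ k → 1 ≤ k → k ≤ n → f k ≡ 0) → sumℕ n f ≡ 0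
  sumℕ-zero zero    f≡0 = refl
  sumℕ-zero (suc n) f≡0 = cong₂ _+_ (f≡0 (suc n) (s≤s z≤n) ≤-refl) (sumℕ-zero n (λ k 1≤k k≤n → f≡0 k 1≤k (m≤n⇒m≤1+n k≤n)))

  sumℕ-indicator : ∀ n d → 1 ≤ d → d ≤ n → sumℕ n (λ q → if d ≡ᵇ q then 1 else 0) ≡ 1
  sumℕ-indicator zero    d 1≤d d≤0 = ⊥-elim (<⇒≱ 1≤d d≤0)
  sumℕ-indicator (suc n) d 1≤d d≤n with d ≟ suc n
  ... | yes refl = cong₂ (λ b m → (if b then 1 else 0) + m) (dec-true (d ≟ suc n) refl)
    (sumℕ-zero n (λ k _ k≤n → cong (if_then 1 else 0) (dec-false (d ≟ k) (λ { refl → <-irrefl refl k≤n }))))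
  ... | no d≢    = trans (cong (λ b → (if b then 1 else 0) + sumℕ n (λ q → if d ≡ᵇ q then 1 else 0)) (dec-false (d ≟ suc n) d≢))
    (sumℕ-indicator n d 1≤d (s≤s⁻¹ (≤∧≢⇒< d≤n d≢)))

  -- For each `a` satisfying `P` exactly one `q` in 1,...,Q equals `d a`, so the fibres of `d`
  -- partition the counted set.
  countUpTo-split : ∀ n Q (d : ℕ → ℕ) P → (∀ a → P a ≡ true → 1 ≤ d a × d a ≤ Q) →
    countUpTo n P ≡ sumℕ Q (λ q → countUpTo n (λ a → (d a ≡ᵇ q) ∧ P a))
  countUpTo-split zero    Q d P P⇒ = sym (sumℕ-zero Q (λ _ _ _ → refl))
  countUpTo-split (suc n) Q d P P⇒ = sym (trans
    (sumℕ-+ Q (λ q → if (d (suc n) ≡ᵇ q) ∧ P (suc n) then 1 else 0) _)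
    (cong₂ _+_ (head (P (suc n)) refl) (sym (countUpTo-split n Q d P P⇒))))
    where
    head : ∀ b → P (suc n) ≡ b → sumℕ Q (λ q → if (d (suc n) ≡ᵇ q) ∧ b then 1 else 0) ≡ (if b then 1 else 0)
    head true  Pn = trans (sumℕ-cong Q (λ q _ _ → cong (if_then 1 else 0) (∧-identityʳ (d (suc n) ≡ᵇ q))))
      (sumℕ-indicator Q (d (suc n)) (proj₁ (P⇒ (suc n) Pn)) (proj₂ (P⇒ (suc n) Pn)))
    head false _ = sumℕ-zero Q (λ q _ _ → cong (if_then 1 else 0) (∧-zeroʳ (d (suc n) ≡ᵇ q)))

  -- Partner a b says that a/x = k/q and b/x = l/q in lowest terms with q ≤ Q and l ≡ -k* (mod q).
  module Farey (Q x : ℕ) {{_ : NonZero x}} where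

    record Partner (a b : ℕ) : Set where
      constructor partner
      field
        g q k l : ℕ
        q≤Q  : q ≤ Q
        gq≡x : g * q ≡ x
        a≡gk : a ≡ g * k
        b≡gl : b ≡ g * l
        q∣   : q ∣ suc (k * l)

      g≢0 : NonZero g
      g≢0 = ≢-nonZero (λ g≡0 → ≢-nonZero⁻¹ x (trans (sym gq≡x) (cong (_* q) g≡0)))

      gcd≡g : gcd a x ≡ g
      gcd≡g = trans (cong₂ gcd a≡gk (sym gq≡x)) (gcd-scaled g k q (∣suc*⇒coprime k l q∣))

    Partner-sym : ∀ {a b} → Partner a b → Partner b a
    Partner-sym (partner g q k l q≤Q gq≡x a≡gk b≡gl q∣) =
      partner g q l k q≤Q gq≡x b≡gl a≡gk (subst (λ m → q ∣ suc m) (*-comm k l) q∣)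

    bounds-cancel : ∀ {b} g q l → .{{NonZero g}} → g * q ≡ x → b ≡ g * l → 1 ≤ b → b ≤ x → 1 ≤ l × l ≤ q
    bounds-cancel g q zero    gq≡x b≡gl 1≤b b≤x = ⊥-elim (<⇒≱ 1≤b (≤-reflexive (trans b≡gl (*-zeroʳ g))))
    bounds-cancel g q (suc l) gq≡x b≡gl 1≤b b≤x = s≤s z≤n , *-cancelˡ-≤ g (subst₂ _≤_ b≡gl (sym gq≡x) b≤x)

    -- The number `g` is `gcd a x`, so `a` determines `g`, then `q` and `k` by cancelling `g`, and
    -- finally `l` as the only solution of `k * l ≡ -1` in 1,...,q.
    Partner-unique : ∀ {a b b′} → Partner a b → Partner a b′ →
      1 ≤ b → b ≤ x → 1 ≤ b′ → b′ ≤ x → b ≡ b′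
    Partner-unique P@(partner g q k l _ gq≡x a≡gk b≡gl q∣)
                   P′@(partner g′ q′ k′ l′ _ gq≡x′ a≡gk′ b≡gl′ q∣′) 1≤b b≤x 1≤b′ b′≤x
      with trans (sym (Partner.gcd≡g P)) (Partner.gcd≡g P′)
    ... | refl with *-cancelˡ-≡ q q′ g {{Partner.g≢0 P}} (trans gq≡x (sym gq≡x′))
                  | *-cancelˡ-≡ k k′ g {{Partner.g≢0 P}} (trans (sym a≡gk) a≡gk′)
    ...   | refl | refl =
      let instance _ = Partner.g≢0 P
          1≤l  , l≤q  = bounds-cancel g q l gq≡x b≡gl 1≤b b≤x
          1≤l′ , l′≤q = bounds-cancel g q l′ gq≡x b≡gl′ 1≤b′ b′≤x
      in trans b≡gl (trans (cong (g *_) (negInverse-unique k q∣ q∣′ 1≤l l≤q 1≤l′ l′≤q)) (sym b≡gl′))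

    -- Reduced denominators and the involution

    denominator : ℕ → ℕ
    denominator a = quotient (gcd[m,n]∣n a x)

    gcd*denominator : ∀ a → gcd a x * denominator a ≡ x
    gcd*denominator a = sym (m∣n⇒n≡m*quotient (gcd[m,n]∣n a x))

    denominator-unique : ∀ a {g q} → gcd a x ≡ g → g * q ≡ x → denominator a ≡ q
    denominator-unique a {g} {q} refl gq≡x = *-cancelˡ-≡ (denominator a) q g
      {{≢-nonZero (gcd[m,n]≢0 a x (inj₂ (≢-nonZero⁻¹ x)))}} (trans (gcd*denominator a) (sym gq≡x))

    FareyPartner : ℕ → Set
    FareyPartner a = ∃ λ b → 1 ≤ b × b ≤ x × Partner a b

    scaled-bounds : ∀ g q l → .{{NonZero g}} → g * q ≡ x → 1 ≤ l → l ≤ q → 1 ≤ g * l × g * l ≤ x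
    scaled-bounds g q l gq≡x 1≤l l≤q = *-mono-≤ (>-nonZero⁻¹ g) 1≤l , subst (g * l ≤_) gq≡x (*-monoʳ-≤ g l≤q)

    fareyPartner : ∀ {a} g p k → suc p ≤ Q → g * suc p ≡ x → a ≡ g * k → gcd k (suc p) ≡ 1 → FareyPartner a
    fareyPartner {a} g p k q≤Q gq≡x a≡gk k⊥q = g * negInv p k , 1≤b , b≤x , P
      where
      P : Partner a (g * negInv p k)
      P = partner g (suc p) k (negInv p k) q≤Q gq≡x a≡gk refl (negInv-spec p k k⊥q)
      bounds = scaled-bounds g (suc p) (negInv p k) {{Partner.g≢0 P}} gq≡x (1≤negInv p k) (negInv≤ p k)
      1≤b = proj₁ bounds
      b≤x = proj₂ bounds

    partner? : ∀ a → FareyPartner a ⊎ (∀ b → ¬ Partner a b)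
    partner? a with denominator a ≤? Q | denominator a in eq
    ... | no q≰Q | _ = inj₂ (λ b P → q≰Q (subst (_≤ Q) (sym (denominator-unique a (Partner.gcd≡g P) (Partner.gq≡x P))) (Partner.q≤Q P)))
    ... | yes _  | zero = ⊥-elim (≢-nonZero⁻¹ x (trans (sym (gcd*denominator a)) (trans (cong (gcd a x *_) eq) (*-zeroʳ (gcd a x)))))
    ... | yes q≤Q | suc p = inj₁ (fareyPartner (gcd a x) p k (subst (_≤ Q) eq q≤Q) gq≡x a≡gk k⊥q)
      where
      k = quotient (gcd[m,n]∣m a x)
      instance
        g≢0 : NonZero (gcd a x)
        g≢0 = ≢-nonZero (gcd[m,n]≢0 a x (inj₂ (≢-nonZero⁻¹ x)))
      a≡gk : a ≡ gcd a x * k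
      a≡gk = m∣n⇒n≡m*quotient (gcd[m,n]∣m a x)
      gq≡x : gcd a x * suc p ≡ x
      gq≡x = trans (cong (gcd a x *_) (sym eq)) (gcd*denominator a)
      k⊥q : gcd k (suc p) ≡ 1
      k⊥q = *-cancelˡ-≡ (gcd k (suc p)) 1 (gcd a x) (trans (c*gcd[m,n]≡gcd[cm,cn] (gcd a x) k (suc p))
        (trans (sym (cong₂ gcd a≡gk (sym gq≡x))) (sym (*-identityʳ (gcd a x)))))

    farey : ℕ → Bool
    farey a with partner? a
    ... | inj₁ _ = true
    ... | inj₂ _ = false

    τ : ℕ → ℕ
    τ a with partner? a
    ... | inj₁ (b , _) = b
    ... | inj₂ _       = a

    -- Uniqueness of partners lets `τ` be evaluated from any partner that can be exhibited,
    -- whichever one the decision procedure constructs.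
    farey-true : ∀ {a b} → Partner a b → 1 ≤ b → b ≤ x → farey a ≡ true × τ a ≡ b
    farey-true {a} {b} P 1≤b b≤x with partner? a
    ... | inj₁ (b′ , 1≤b′ , b′≤x , P′) = refl , Partner-unique P′ P 1≤b′ b′≤x 1≤b b≤x
    ... | inj₂ none = ⊥-elim (none b P)

    farey⇒Partner : ∀ a → farey a ≡ true → 1 ≤ τ a × τ a ≤ x × Partner a (τ a)
    farey⇒Partner a _ with partner? a
    farey⇒Partner a _  | inj₁ (b , P) = P
    farey⇒Partner a () | inj₂ _

    ¬farey⇒τ≡ : ∀ a → farey a ≡ false → τ a ≡ a
    ¬farey⇒τ≡ a _ with partner? a
    ¬farey⇒τ≡ a () | inj₁ _
    ¬farey⇒τ≡ a _  | inj₂ _ = refl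

    τ-bounds : ∀ a → 1 ≤ a → a ≤ x → 1 ≤ τ a × τ a ≤ x
    τ-bounds a 1≤a a≤x with farey a in eq
    ... | true  = let 1≤ , ≤x , _ = farey⇒Partner a eq in 1≤ , ≤x
    ... | false = subst (λ b → 1 ≤ b × b ≤ x) (sym (¬farey⇒τ≡ a eq)) (1≤a , a≤x)

    -- `Partner` is symmetric, so `a` is a partner of `τ a`, and by uniqueness it is the one that
    -- `τ` selects; outside the Farey exponents `τ` is the identity.
    τ-involutive : ∀ a → 1 ≤ a → a ≤ x → farey (τ a) ≡ farey a × τ (τ a) ≡ a
    τ-involutive a 1≤a a≤x with farey a in eq
    ... | true  = farey-true (Partner-sym (proj₂ (proj₂ (farey⇒Partner a eq)))) 1≤a a≤x
    ... | false = trans (cong farey τa≡a) eq , trans (cong τ τa≡a) τa≡a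
      where τa≡a = ¬farey⇒τ≡ a eq

    -- The exponents with reduced denominator `q` are the `g * k` with `g = x / q` and `k` in
    -- 1,...,q coprime to `q`. A count over exponents thus becomes a double count over fractions,
    -- with `c` expressing `P` in terms of `k` and `q`.
    count-by-denominator : (∀ q → 1 ≤ q → q ≤ Q → q ∣ x) → (P : ℕ → Bool) (c : ℕ → ℕ → Bool) →
      (∀ a → P a ≡ true → 1 ≤ denominator a × denominator a ≤ Q) →
      (∀ g q k → g * q ≡ x → 1 ≤ q → q ≤ Q → 1 ≤ k → k ≤ q → gcd k q ≡ 1 → P (g * k) ≡ c q k) →
      countUpTo x P ≡ sumℕ Q (λ q → countUpTo q (λ k → coprimeᵇ k q ∧ c q k))
    count-by-denominator ∣x P c P⇒ P-val =
      trans (countUpTo-split x Q denominator P P⇒) (sumℕ-cong Q per-denominator)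
      where
      per-denominator : ∀ q → 1 ≤ q → q ≤ Q →
        countUpTo x (λ a → (denominator a ≡ᵇ q) ∧ P a) ≡ countUpTo q (λ k → coprimeᵇ k q ∧ c q k)
      per-denominator q 1≤q q≤Q = begin
        countUpTo x P′                       ≡⟨ cong (λ n → countUpTo n P′) x≡qg ⟩
        countUpTo (q * g) P′                 ≡⟨ countUpTo-multiples q g P′ multiple ⟩
        countUpTo q (λ k → P′ (k * g))       ≡⟨ countUpTo-cong q value ⟩
        countUpTo q (λ k → coprimeᵇ k q ∧ c q k) ∎
        where
        open ≡-Reasoning
        g = quotient (∣x q 1≤q q≤Q)
        gq≡x : g * q ≡ x
        gq≡x = sym (m∣n⇒n≡quotient*m (∣x q 1≤q q≤Q))
        x≡qg : x ≡ q * g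
        x≡qg = m∣n⇒n≡m*quotient (∣x q 1≤q q≤Q)
        instance
          q≢0 : NonZero q
          q≢0 = >-nonZero 1≤q
          g≢0 : NonZero g
          g≢0 = ≢-nonZero (λ g≡0 → ≢-nonZero⁻¹ x (trans (sym gq≡x) (cong (_* q) g≡0)))
        P′ : ℕ → Bool
        P′ a = (denominator a ≡ᵇ q) ∧ P a
        denominator⇒gcd : ∀ a → denominator a ≡ q → gcd a x ≡ g
        denominator⇒gcd a d≡q = *-cancelʳ-≡ (gcd a x) g q
          (trans (cong (gcd a x *_) (sym d≡q)) (trans (gcd*denominator a) (sym gq≡x)))
        multiple : ∀ a → P′ a ≡ true → g ∣ a
        multiple a P′a with denominator a ≟ q
        ... | yes d≡q = subst (_∣ a) (denominator⇒gcd a d≡q) (gcd[m,n]∣m a x)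
        ... | no d≢q with () ← trans (sym P′a) (cong (_∧ P a) (dec-false (denominator a ≟ q) d≢q))
        value : ∀ k → 1 ≤ k → k ≤ q → P′ (k * g) ≡ coprimeᵇ k q ∧ c q k
        value k 1≤k k≤q with gcd k q ≟ 1
        ... | yes k⊥q = cong₂ _∧_
          (trans (dec-true (denominator (k * g) ≟ q) d≡q) (sym (dec-true (gcd k q ≟ 1) k⊥q)))
          (trans (cong P (*-comm k g)) (P-val g q k gq≡x 1≤q q≤Q 1≤k k≤q k⊥q))
          where
          d≡q : denominator (k * g) ≡ q
          d≡q = denominator-unique (k * g)
            (trans (cong₂ gcd (*-comm k g) (sym gq≡x)) (gcd-scaled g k q k⊥q)) gq≡x
        -- If `k * g` had denominator `q`, its gcd with `x = g * q` would be `g`, and cancelling `g`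
        -- would make `k` coprime to `q`.
        ... | no k⊥̸q = trans (cong (_∧ P (k * g)) (dec-false (denominator (k * g) ≟ q) (λ d≡q → k⊥̸q
          (*-cancelˡ-≡ (gcd k q) 1 g (trans (c*gcd[m,n]≡gcd[cm,cn] g k q)
            (trans (cong₂ gcd (*-comm g k) gq≡x) (trans (denominator⇒gcd (k * g) d≡q) (sym (*-identityʳ g)))))))))
            (sym (cong (_∧ c q k) (dec-false (gcd k q ≟ 1) k⊥̸q)))

    farey-denominator : ∀ a → farey a ≡ true → 1 ≤ denominator a × denominator a ≤ Q
    farey-denominator a fa with partner g q k l q≤Q gq≡x a≡gk b≡gl q∣ ← proj₂ (proj₂ (farey⇒Partner a fa)) =
      subst (λ d → 1 ≤ d × d ≤ Q) (sym (denominator-unique a (Partner.gcd≡g (partner g q k l q≤Q gq≡x a≡gk b≡gl q∣)) gq≡x))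
        (>-nonZero⁻¹ q {{≢-nonZero (λ q≡0 → ≢-nonZero⁻¹ x (trans (sym gq≡x) (trans (cong (g *_) q≡0) (*-zeroʳ g))))}} , q≤Q)

    scaled-farey : ∀ g p k → g * suc p ≡ x → suc p ≤ Q → gcd k (suc p) ≡ 1 →
      farey (g * k) ≡ true × τ (g * k) ≡ g * negInv p k
    scaled-farey g p k gq≡x q≤Q k⊥q =
      let b , 1≤b , b≤x , P = fareyPartner g p k q≤Q gq≡x refl k⊥q in farey-true P 1≤b b≤x

    count-farey : (∀ q → 1 ≤ q → q ≤ Q → q ∣ x) → countUpTo x farey ≡ Φ Q
    count-farey ∣x = trans
      (count-by-denominator ∣x farey (λ _ _ → true) farey-denominator
        (λ { g (suc p) k gq≡x _ q≤Q _ _ k⊥q → proj₁ (scaled-farey g p k gq≡x q≤Q k⊥q) }))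
      (sumℕ-cong Q (λ q _ _ → countUpTo-cong q (λ k _ _ → ∧-identityʳ (coprimeᵇ k q))))

    fixed : ℕ → Bool
    fixed a = farey a ∧ (τ a ≡ᵇ a)

    -- A Farey exponent `g * k` is fixed exactly when `k` is its own negative inverse, that is
    -- `k + k* ≡ 0 (mod q)`, the condition counted by `φ̃`.
    count-fixed : (∀ q → 1 ≤ q → q ≤ Q → q ∣ x) → countUpTo x fixed ≡ Φ̃ Q
    count-fixed ∣x = trans
      (count-by-denominator ∣x fixed c (λ a fa → farey-denominator a (∧-true fa)) value)
      (sumℕ-cong Q (λ { (suc p) _ _ → refl }))
      where
      ∧-true : ∀ {a b} → a ∧ b ≡ true → a ≡ true
      ∧-true {true} _ = refl
      c : ℕ → ℕ → Bool
      c zero    k = true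
      c (suc p) k = ((k + inv p k) % suc p) ≡ᵇ 0
      value : ∀ g q k → g * q ≡ x → 1 ≤ q → q ≤ Q → 1 ≤ k → k ≤ q → gcd k q ≡ 1 → fixed (g * k) ≡ c q k
      value g q@(suc p) k gq≡x 1≤q q≤Q 1≤k k≤q k⊥q =
        trans (cong₂ (λ f b → f ∧ (b ≡ᵇ g * k)) f≡true τ≡) equiv
        where
        f≡true = proj₁ (scaled-farey g p k gq≡x q≤Q k⊥q)
        τ≡ = proj₂ (scaled-farey g p k gq≡x q≤Q k⊥q)
        instance
          g≢0 : NonZero g
          g≢0 = ≢-nonZero (λ g≡0 → ≢-nonZero⁻¹ x (trans (sym gq≡x) (cong (_* q) g≡0)))
        ki≡1 = proj₁ (inv-spec p k k⊥q)
        equiv : (g * negInv p k ≡ᵇ g * k) ≡ (((k + inv p k) % q) ≡ᵇ 0)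
        equiv with (k + inv p k) % q ≟ 0
        ... | yes k+i≡0 = trans (dec-true (g * negInv p k ≟ g * k) (cong (g *_) (negInverse-unique k
                (negInv-spec p k k⊥q)
                (∣inv+⇒∣suc* p k (inv p k) k ki≡1 (subst (q ∣_) (+-comm k (inv p k)) (m%n≡0⇒n∣m _ q k+i≡0)))
                (1≤negInv p k) (negInv≤ p k) 1≤k k≤q)))
                (sym (dec-true ((k + inv p k) % q ≟ 0) k+i≡0))
        ... | no k+i≢0 = trans (dec-false (g * negInv p k ≟ g * k) (λ e → k+i≢0 (n∣m⇒m%n≡0 _ q
                (subst (q ∣_) (+-comm (inv p k) k) (∣suc*⇒∣inv+ p k (inv p k) k k⊥q ki≡1
                  (subst (λ l → q ∣ suc (k * l)) (*-cancelˡ-≡ (negInv p k) k g e) (negInv-spec p k k⊥q)))))))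
                (sym (dec-false ((k + inv p k) % q ≟ 0) k+i≢0))

    Partner-q-unique : ∀ {a b b′} (P : Partner a b) (P′ : Partner a b′) → Partner.q P ≡ Partner.q P′
    Partner-q-unique {a} P P′ = trans (sym (denominator-unique a (Partner.gcd≡g P) (Partner.gq≡x P)))
      (denominator-unique a (Partner.gcd≡g P′) (Partner.gq≡x P′))

    -- This congruence is what makes the exponential sum over n non-zero in the term k of S(m,n;q).
    congruence⇒Partner : ∀ {a} g p k → suc p ≤ Q → g * suc p ≡ x → gcd k (suc p) ≡ 1 →
      x ∣ g * inv p k + a → ∃ λ (P : Partner a (g * k)) → Partner.q P ≡ suc p
    congruence⇒Partner {a} g p k q≤Q gq≡x k⊥q x∣ =
      partner g (suc p) m k q≤Q gq≡x a≡gm refl (subst (λ n → suc p ∣ suc n) (*-comm k m) q∣) , refl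
      where
      instance
        g≢0 : NonZero g
        g≢0 = ≢-nonZero (λ g≡0 → ≢-nonZero⁻¹ x (trans (sym gq≡x) (cong (_* suc p) g≡0)))
      g∣a : g ∣ a
      g∣a = ∣m+n∣m⇒∣n (∣-trans (subst (g ∣_) gq≡x (m∣m*n (suc p))) x∣) (m∣m*n (inv p k))
      m = quotient g∣a
      a≡gm : a ≡ g * m
      a≡gm = m∣n⇒n≡m*quotient g∣a
      q∣ : suc p ∣ suc (k * m)
      q∣ = ∣inv+⇒∣suc* p k (inv p k) m (proj₁ (inv-spec p k k⊥q)) (*-cancelˡ-∣ g (subst₂ _∣_ (sym gq≡x)
        (trans (cong (g * inv p k +_) a≡gm) (sym (*-distribˡ-+ g (inv p k) m))) x∣))

    -- The converse direction: the numerator of a partner does satisfy the congruence, so its term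
    -- of the exponential sum survives.
    Partner⇒congruence : ∀ {a} g p k m → g * suc p ≡ x → a ≡ g * m → suc p ∣ suc (m * k) →
      gcd k (suc p) ≡ 1 × x ∣ g * inv p k + a
    Partner⇒congruence g p k m gq≡x refl q∣ = k⊥q , subst₂ _∣_ gq≡x (*-distribˡ-+ g (inv p k) m)
      (*-monoʳ-∣ g (∣suc*⇒∣inv+ p k (inv p k) m k⊥q (proj₁ (inv-spec p k k⊥q)) q∣′))
      where
      q∣′ : suc p ∣ suc (k * m)
      q∣′ = subst (λ n → suc p ∣ suc n) (*-comm m k) q∣
      k⊥q = ∣suc*⇒coprime k m q∣′

open Arithmetic

open import Level using (Level)
open import Algebra.Bundles using (CommutativeRing)
open import Data.Bool using (Bool; true; false; if_then_else_; not; _∧_)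
open import Data.Empty using (⊥; ⊥-elim)
open import Data.Fin using (Fin; zero; suc; toℕ; fromℕ<; inject₁; punchIn; _≟_)
import Data.Fin as F
open import Data.Fin.Induction using (<-weakInduction)
open import Data.Fin.Permutation using (permutation)
open import Data.Fin.Properties using (toℕ<n; toℕ-fromℕ<; toℕ-inject₁; toℕ-injective; suc-injective; <-cmp; <⇒≢)
open import Data.Nat using (ℕ; zero; suc; _∸_; _/_; _<_; _≤_; NonZero; z≤n; s≤s)
import Data.Nat as N
import Data.Nat.Properties as N
open import Data.Nat.DivMod using (m≡m%n+[m/n]*n; m%n<n; m*n/n≡m)
open import Data.Nat.Divisibility using (_∣_; divides; _∣?_; m%n≡0⇒n∣m; ∣⇒≤; ∣m+n∣m⇒∣n; ∣-refl)
open import Data.Nat.GCD using (gcd)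
open import Data.Nat.Solver using (module +-*-Solver)
open import Data.Product using (_×_; _,_; proj₁; proj₂)
open import Data.Sum using (_⊎_; inj₁; inj₂)
open import Data.Vec.Functional using (_∷_)
open import Function using (_∘_)
open import Relation.Binary.Definitions using (Tri; tri<; tri≈; tri>)
open import Relation.Binary.PropositionalEquality using (_≡_; _≢_; ≢-sym; module ≡-Reasoning)
  renaming (refl to ≡-refl; sym to ≡-sym; trans to ≡-trans; cong to ≡-cong; cong₂ to ≡-cong₂; subst to ≡-subst)
open import Relation.Nullary using (¬_; yes; no; does)
open import Relation.Nullary.Decidable using (dec-true; dec-false)
open import Algebra.Properties.CommutativeMonoid.Sum N.+-0-commutativeMonoid
  using (sum; sum-cong-≗; ∑-distrib-+; sum-permute)
import Algebra.Solver.Ring.NaturalCoefficients.Default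

-- Determinants

-- For `a ≤ b` the columns `inject₁ a` and `suc b` form a typical pair of distinct columns. Deleting
-- `inject₁ a` and then `b`, or `suc b` and then `a`, removes this pair in its two orders;
-- `punchIn-punchIn` says that the same columns remain.
punchIn-inject₁-≤ : ∀ {n} (a b : Fin (suc n)) → toℕ a N.≤ toℕ b → punchIn (inject₁ a) b ≡ suc b
punchIn-inject₁-≤ zero    b       _         = ≡-refl
punchIn-inject₁-≤ {suc n} (suc a) (suc b) (N.s≤s a≤b) = ≡-cong suc (punchIn-inject₁-≤ a b a≤b)

punchIn-suc-≤ : ∀ {n} (a b : Fin (suc n)) → toℕ a N.≤ toℕ b → punchIn (suc b) a ≡ inject₁ a
punchIn-suc-≤ zero    b       _         = ≡-refl
punchIn-suc-≤ {suc n} (suc a) (suc b) (N.s≤s a≤b) = ≡-cong suc (punchIn-suc-≤ a b a≤b)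

-- The maps `punchIn (inject₁ a)` and `punchIn (suc a)` differ only at `a`, so moving the omitted
-- index by one amounts to a single transposition.
punchIn-inject₁-≡ : ∀ {n} (a : Fin n) → punchIn (inject₁ a) a ≡ suc a
punchIn-inject₁-≡ zero    = ≡-refl
punchIn-inject₁-≡ (suc a) = ≡-cong suc (punchIn-inject₁-≡ a)

punchIn-suc-≡ : ∀ {n} (a : Fin n) → punchIn (suc a) a ≡ inject₁ a
punchIn-suc-≡ zero    = ≡-refl
punchIn-suc-≡ (suc a) = ≡-cong suc (punchIn-suc-≡ a)

punchIn-inject₁-suc : ∀ {n} (a b : Fin n) → b ≢ a → punchIn (inject₁ a) b ≡ punchIn (suc a) b
punchIn-inject₁-suc zero    zero    b≢a = ⊥-elim (b≢a ≡-refl)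
punchIn-inject₁-suc zero    (suc b) b≢a = ≡-refl
punchIn-inject₁-suc (suc a) zero    b≢a = ≡-refl
punchIn-inject₁-suc (suc a) (suc b) b≢a = ≡-cong suc (punchIn-inject₁-suc a b (b≢a ∘ ≡-cong suc))

punchIn-punchIn : ∀ {n} (a b : Fin (suc n)) → toℕ a N.≤ toℕ b → (c : Fin n) →
  punchIn (inject₁ a) (punchIn b c) ≡ punchIn (suc b) (punchIn a c)
punchIn-punchIn zero    b       _           c       = ≡-refl
punchIn-punchIn (suc a) (suc b) (N.s≤s a≤b) zero    = ≡-refl
punchIn-punchIn (suc a) (suc b) (N.s≤s a≤b) (suc c) = ≡-cong suc (punchIn-punchIn a b a≤b c)

module Determinant {c ℓ : Level} (R : CommutativeRing c ℓ) where
  open CommutativeRing R hiding (zero)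
  open RingDefs R
  open import Algebra.Properties.Ring ring
  open import Algebra.Properties.CommutativeSemigroup *-commutativeSemigroup using () renaming (x∙yz≈y∙xz to x*yz≈y*xz)
  open import Algebra.Properties.CommutativeSemigroup +-commutativeSemigroup using () renaming (x∙yz≈y∙xz to x+yz≈y+xz; interchange to +-interchange)
  open import Relation.Binary.Reasoning.Setoid setoid
  module ℕ-Solver = Algebra.Solver.Ring.NaturalCoefficients.Default commutativeSemiring

  -- Rows, finite sums and the identity matrix

  Row : ℕ → Set c
  Row n = Fin n → Carrier

  Matrix : ℕ → ℕ → Set c
  Matrix m n = Fin m → Row n

  infix 4 _≈ʳ_ _≈ᴹ_
  _≈ʳ_ : ∀ {n} → Row n → Row n → Set ℓ
  u ≈ʳ v = ∀ j → u j ≈ v j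

  _≈ᴹ_ : ∀ {m n} → Matrix m n → Matrix m n → Set ℓ
  M ≈ᴹ N = ∀ i → M i ≈ʳ N i

  sumFin-cong : ∀ n {f g : Row n} → f ≈ʳ g → sumFin n f ≈ sumFin n g
  sumFin-cong zero    f≈g = refl
  sumFin-cong (suc n) f≈g = +-cong (f≈g zero) (sumFin-cong n (f≈g ∘ suc))

  sumFin-zero : ∀ n {f : Row n} → (∀ j → f j ≈ 0#) → sumFin n f ≈ 0#
  sumFin-zero zero    f≈0 = refl
  sumFin-zero (suc n) f≈0 = trans (+-cong (f≈0 zero) (sumFin-zero n (f≈0 ∘ suc))) (+-identityˡ 0#)

  sumFin-+ : ∀ n (f g : Row n) → sumFin n (λ j → f j + g j) ≈ sumFin n f + sumFin n g
  sumFin-+ zero    f g = sym (+-identityˡ 0#)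
  sumFin-+ (suc n) f g = trans (+-congˡ (sumFin-+ n (f ∘ suc) (g ∘ suc))) (+-interchange _ _ _ _)

  *-sumFin : ∀ n a (f : Row n) → a * sumFin n f ≈ sumFin n (λ j → a * f j)
  *-sumFin zero    a f = zeroʳ a
  *-sumFin (suc n) a f = trans (distribˡ a _ _) (+-congˡ (*-sumFin n a (f ∘ suc)))

  sumFin-* : ∀ n a (f : Row n) → sumFin n f * a ≈ sumFin n (λ j → f j * a)
  sumFin-* n a f = trans (*-comm _ a) (trans (*-sumFin n a f) (sumFin-cong n (λ j → *-comm a (f j))))

  sumFin-remove : ∀ n (f : Row (suc n)) j → sumFin (suc n) f ≈ f j + sumFin n (f ∘ punchIn j)
  sumFin-remove n       f zero    = refl
  sumFin-remove (suc n) f (suc j) = trans (+-congˡ (sumFin-remove n (f ∘ suc) j)) (x+yz≈y+xz _ _ _)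

  -- The identity matrix by recursion on both indices, which follows the recursion of sums and
  -- determinants, unlike the comparison of numbers in `idMat`.
  δ : ∀ {n} → Matrix n n
  δ zero    zero    = 1#
  δ zero    (suc j) = 0#
  δ (suc i) zero    = 0#
  δ (suc i) (suc j) = δ i j

  δ-diag : ∀ {n} (i : Fin n) → δ i i ≈ 1#
  δ-diag zero    = refl
  δ-diag (suc i) = δ-diag i

  δ-off : ∀ {n} {i j : Fin n} → i ≢ j → δ i j ≈ 0#
  δ-off {i = zero}  {zero}  i≢j = ⊥-elim (i≢j ≡-refl)
  δ-off {i = zero}  {suc j} i≢j = refl
  δ-off {i = suc i} {zero}  i≢j = refl
  δ-off {i = suc i} {suc j} i≢j = δ-off (i≢j ∘ ≡-cong suc)

  δ-sym : ∀ {n} (i j : Fin n) → δ i j ≈ δ j i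
  δ-sym zero    zero    = refl
  δ-sym zero    (suc j) = refl
  δ-sym (suc i) zero    = refl
  δ-sym (suc i) (suc j) = δ-sym i j

  idMat≈δ : ∀ n → idMat n ≈ᴹ δ
  idMat≈δ (suc n) zero    zero    = refl
  idMat≈δ (suc n) zero    (suc j) = refl
  idMat≈δ (suc n) (suc i) zero    = refl
  idMat≈δ (suc n) (suc i) (suc j) with toℕ i N.≡ᵇ toℕ j | idMat≈δ n i j
  ... | true  | p = p
  ... | false | p = p

  δ-sumˡ : ∀ {n} i (f : Row n) → sumFin n (λ j → δ i j * f j) ≈ f i
  δ-sumˡ {suc n} zero f = begin
    1# * f zero + sumFin n (λ j → 0# * f (suc j)) ≈⟨ +-cong (*-identityˡ _) (sumFin-zero n (λ j → zeroˡ _)) ⟩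
    f zero + 0#                                   ≈⟨ +-identityʳ _ ⟩
    f zero                                        ∎
  δ-sumˡ {suc n} (suc i) f = trans (+-cong (zeroˡ _) (δ-sumˡ i (f ∘ suc))) (+-identityˡ _)

  δ-sumʳ : ∀ {n} i (f : Row n) → sumFin n (λ j → f j * δ j i) ≈ f i
  δ-sumʳ {n} i f = trans (sumFin-cong n (λ j → trans (*-comm _ _) (*-congʳ (δ-sym j i)))) (δ-sumˡ i f)

  infixl 7 _·_
  _·_ : ∀ {m n p} → Matrix m n → Matrix n p → Matrix m p
  _·_ {n = n} A B i k = sumFin n (λ j → A i j * B j k)

  ·-congʳ : ∀ {n p} {u v : Row n} (B : Matrix n p) → u ≈ʳ v →
    (λ k → sumFin n (λ j → u j * B j k)) ≈ʳ (λ k → sumFin n (λ j → v j * B j k))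
  ·-congʳ {n} B u≈v k = sumFin-cong n (λ j → *-congʳ (u≈v j))

  -- Multilinear and alternating functions of the rows

  record Multilinear {m n} (D : Matrix m n → Carrier) : Set (c Level.⊔ ℓ) where
    field
      D-cong : ∀ {M M′} → M ≈ᴹ M′ → D M ≈ D M′
      -- Linearity relates three matrices that agree off row `i`, so no operation replacing a row is
      -- involved and the property passes directly to minors and products.
      D-linear : ∀ i a {M M′ M″} →
        (∀ k → k ≢ i → M k ≈ʳ M′ k) → (∀ k → k ≢ i → M k ≈ʳ M″ k) →
        (∀ j → M i j ≈ M′ i j + a * M″ i j) → D M ≈ D M′ + a * D M″

    -- A zero row equals itself plus -1 times itself, so linearity gives `D M = D M - D M`.
    D-zeroRow : ∀ i {M} → (∀ j → M i j ≈ 0#) → D M ≈ 0#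
    D-zeroRow i {M} Mi≈0 = begin
      D M                ≈⟨ D-linear i (- 1#) (λ _ _ _ → refl) (λ _ _ _ → refl)
                              (λ j → trans (Mi≈0 j) (sym (trans (+-congˡ (-1*x≈-x _)) (-‿inverseʳ _)))) ⟩
      D M + - 1# * D M   ≈⟨ +-congˡ (-1*x≈-x _) ⟩
      D M + - D M        ≈⟨ -‿inverseʳ _ ⟩
      0#                 ∎

  open Multilinear

  ∷-linear : ∀ {m n} {D : Matrix (suc m) n → Carrier} → Multilinear D → ∀ u v a M →
    D ((λ j → u j + a * v j) ∷ M) ≈ D (u ∷ M) + a * D (v ∷ M)
  ∷-linear D-ml u v a M = D-linear D-ml zero a off off (λ _ → refl)
    where
    off : ∀ {w w′} k → k ≢ zero → (w ∷ M) k ≈ʳ (w′ ∷ M) k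
    off zero    k≢0 = ⊥-elim (k≢0 ≡-refl)
    off (suc k) k≢0 = λ _ → refl

  ∷-cong : ∀ {m n} {u v : Row n} {M M′ : Matrix m n} → u ≈ʳ v → M ≈ᴹ M′ → (u ∷ M) ≈ᴹ (v ∷ M′)
  ∷-cong u≈v M≈M′ zero    = u≈v
  ∷-cong u≈v M≈M′ (suc i) = M≈M′ i

  ∷-multilinear : ∀ {m n} {D : Matrix (suc m) n → Carrier} → Multilinear D → ∀ u → Multilinear (λ M → D (u ∷ M))
  ∷-multilinear D-ml u .D-cong M≈M′ = D-cong D-ml (∷-cong (λ _ → refl) M≈M′)
  ∷-multilinear D-ml u .D-linear i a M≈M′ M≈M″ Mi =
    D-linear D-ml (suc i) a (off M≈M′) (off M≈M″) Mi
    where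
    off : ∀ {M M′} → (∀ k → k ≢ i → M k ≈ʳ M′ k) → ∀ k → k ≢ suc i → (u ∷ M) k ≈ʳ (u ∷ M′) k
    off M≈M′ zero    k≢ = λ _ → refl
    off M≈M′ (suc k) k≢ = M≈M′ k (k≢ ∘ ≡-cong suc)

  ∷-sum : ∀ {m n} {D : Matrix (suc m) n → Carrier} → Multilinear D → ∀ p (a : Row p) (V : Matrix p n) M →
    D ((λ j → sumFin p (λ k → a k * V k j)) ∷ M) ≈ sumFin p (λ k → a k * D (V k ∷ M))
  ∷-sum D-ml zero    a V M = D-zeroRow D-ml zero (λ _ → refl)
  ∷-sum {D = D} D-ml (suc p) a V M = begin
    D ((λ j → a zero * V zero j + sumFin p (λ k → a (suc k) * V (suc k) j)) ∷ M)
      ≈⟨ D-cong D-ml (∷-cong (λ _ → +-comm _ _) (λ _ _ → refl)) ⟩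
    D ((λ j → sumFin p (λ k → a (suc k) * V (suc k) j) + a zero * V zero j) ∷ M)
      ≈⟨ ∷-linear D-ml _ _ _ M ⟩
    D ((λ j → sumFin p (λ k → a (suc k) * V (suc k) j)) ∷ M) + a zero * D (V zero ∷ M)
      ≈⟨ +-congʳ (∷-sum D-ml p (a ∘ suc) (V ∘ suc) M) ⟩
    sumFin p (λ k → a (suc k) * D (V (suc k) ∷ M)) + a zero * D (V zero ∷ M)
      ≈⟨ +-comm _ _ ⟩
    a zero * D (V zero ∷ M) + sumFin p (λ k → a (suc k) * D (V (suc k) ∷ M)) ∎

  -- Expanding one row at a time, each extra term has `v` as a row and vanishes. With `v` a unit
  -- vector this clears a column.
  add-multiples : ∀ m {n} {D : Matrix m n → Carrier} → Multilinear D → ∀ v →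
    (∀ i M → M i ≈ʳ v → D M ≈ 0#) → ∀ (a : Row m) M → D (λ i j → M i j + a i * v j) ≈ D M
  add-multiples zero    D-ml v D-v≈0 a M = D-cong D-ml (λ ())
  add-multiples (suc m) {D = D} D-ml v D-v≈0 a M = begin
    D (λ i j → M i j + a i * v j)
      ≈⟨ D-cong D-ml (λ { zero _ → refl ; (suc _) _ → refl }) ⟩
    D ((λ j → M zero j + a zero * v j) ∷ M⁺)
      ≈⟨ ∷-linear D-ml _ _ _ M⁺ ⟩
    D (M zero ∷ M⁺) + a zero * D (v ∷ M⁺)
      ≈⟨ +-congˡ (trans (*-congˡ (D-v≈0 zero (v ∷ M⁺) (λ _ → refl))) (zeroʳ _)) ⟩
    D (M zero ∷ M⁺) + 0#
      ≈⟨ +-identityʳ _ ⟩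
    D (M zero ∷ M⁺)
      ≈⟨ add-multiples m (∷-multilinear D-ml (M zero)) v (λ i N → D-v≈0 (suc i) (M zero ∷ N)) (a ∘ suc) (M ∘ suc) ⟩
    D (M zero ∷ (M ∘ suc))
      ≈⟨ D-cong D-ml (λ { zero _ → refl ; (suc _) _ → refl }) ⟩
    D M ∎
    where M⁺ = λ i j → M (suc i) j + a (suc i) * v j

  -- Vanishing on equal rows implies the change of sign under swaps; the converse would require
  -- cancelling 2.
  Alternating : ∀ {m n} → (Matrix m n → Carrier) → Set (c Level.⊔ ℓ)
  Alternating D = ∀ i k → i ≢ k → ∀ M → M i ≈ʳ M k → D M ≈ 0#

  module _ {m n} {D : Matrix m n → Carrier} (D-ml : Multilinear D) (D-alt : Alternating D) where

    -- Polarisation: with `a + b` in both rows the value is 0, and after expansion the two terms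
    -- with equal rows vanish, leaving `E a b + E b a = 0`.
    alternating⇒swap : ∀ i k → i ≢ k → ∀ M M′ → M′ i ≈ʳ M k → M′ k ≈ʳ M i →
      (∀ r → r ≢ i → r ≢ k → M′ r ≈ʳ M r) → D M′ ≈ - D M
    alternating⇒swap i k i≢k M M′ M′i M′k M′r = +-inverseʳ-unique (D M) (D M′) (begin
      D M + D M′                            ≈⟨ +-cong (D-cong D-ml M≈) (D-cong D-ml M′≈) ⟩
      E a b + E b a                         ≈⟨ +-cong (sym (+-identityˡ _)) (sym (+-identityʳ _)) ⟩
      (0# + E a b) + (E b a + 0#)           ≈⟨ +-cong (+-congʳ (sym (E-diag a))) (+-congˡ (sym (E-diag b))) ⟩
      (E a a + E a b) + (E b a + E b b)     ≈⟨ sym (+-cong (Eʳ a) (Eʳ b)) ⟩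
      E a (λ j → a j + 1# * b j) + E b (λ j → a j + 1# * b j) ≈⟨ sym (Eˡ _) ⟩
      E (λ j → a j + 1# * b j) (λ j → a j + 1# * b j) ≈⟨ E-diag _ ⟩
      0#                                    ∎)
      where
      a b : Row n
      a = M i
      b = M k
      set : Row n → Row n → Matrix m n
      set u w r with r ≟ i | r ≟ k
      ... | yes _ | _     = u
      ... | no _  | yes _ = w
      ... | no _  | no _  = M r
      set-i : ∀ u w → set u w i ≈ʳ u
      set-i u w j with i ≟ i | i ≟ k
      ... | yes _ | _  = refl
      ... | no i≢i | _ = ⊥-elim (i≢i ≡-refl)
      set-k : ∀ u w → set u w k ≈ʳ w
      set-k u w j with k ≟ i | k ≟ k
      ... | yes k≡i | _     = ⊥-elim (i≢k (≡-sym k≡i))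
      ... | no _    | yes _ = refl
      ... | no _    | no k≢k = ⊥-elim (k≢k ≡-refl)
      set-off-i : ∀ {u u′ w} r → r ≢ i → set u w r ≈ʳ set u′ w r
      set-off-i r r≢i j with r ≟ i | r ≟ k
      ... | yes r≡i | _     = ⊥-elim (r≢i r≡i)
      ... | no _    | yes _ = refl
      ... | no _    | no _  = refl
      set-off-k : ∀ {u w w′} r → r ≢ k → set u w r ≈ʳ set u w′ r
      set-off-k r r≢k j with r ≟ i | r ≟ k
      ... | yes _ | _       = refl
      ... | no _  | yes r≡k = ⊥-elim (r≢k r≡k)
      ... | no _  | no _    = refl
      M≈ : M ≈ᴹ set a b
      M≈ r j with r ≟ i | r ≟ k
      ... | yes ≡-refl | _          = refl
      ... | no _       | yes ≡-refl = refl
      ... | no _       | no _       = refl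
      M′≈ : M′ ≈ᴹ set b a
      M′≈ r j with r ≟ i | r ≟ k
      ... | yes ≡-refl | _          = M′i j
      ... | no _       | yes ≡-refl = M′k j
      ... | no r≢i     | no r≢k     = M′r r r≢i r≢k j
      E : Row n → Row n → Carrier
      E u w = D (set u w)
      E-diag : ∀ u → E u u ≈ 0#
      E-diag u = D-alt i k i≢k (set u u) (λ j → trans (set-i u u j) (sym (set-k u u j)))
      Eˡ : ∀ w → E (λ j → a j + 1# * b j) w ≈ E a w + E b w
      Eˡ w = trans
        (D-linear D-ml i 1# set-off-i set-off-i
          (λ j → trans (set-i _ w j) (sym (+-cong (set-i a w j) (*-congˡ (set-i b w j))))))
        (+-congˡ (*-identityˡ _))
      Eʳ : ∀ u → E u (λ j → a j + 1# * b j) ≈ E u a + E u b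
      Eʳ u = trans
        (D-linear D-ml k 1# set-off-k set-off-k
          (λ j → trans (set-k u _ j) (sym (+-cong (set-k u a j) (*-congˡ (set-k u b j))))))
        (+-congˡ (*-identityˡ _))

    ∘·-multilinear : ∀ {p} (P : Matrix p n) → Multilinear (λ (M : Matrix m p) → D (M · P))
    ∘·-multilinear P .D-cong M≈M′ = D-cong D-ml (λ i → ·-congʳ P (M≈M′ i))
    ∘·-multilinear {p} P .D-linear i a {M} {M′} {M″} M≈M′ M≈M″ Mi = D-linear D-ml i a
      (λ k k≢i → ·-congʳ P (M≈M′ k k≢i)) (λ k k≢i → ·-congʳ P (M≈M″ k k≢i))
      (λ j → begin
        sumFin p (λ l → M i l * P l j)
          ≈⟨ sumFin-cong p (λ l → trans (*-congʳ (Mi l)) (trans (distribʳ _ _ _) (+-congˡ (*-assoc _ _ _)))) ⟩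
        sumFin p (λ l → M′ i l * P l j + a * (M″ i l * P l j))  ≈⟨ sumFin-+ p _ _ ⟩
        sumFin p (λ l → M′ i l * P l j) + sumFin p (λ l → a * (M″ i l * P l j)) ≈⟨ +-congˡ (sym (*-sumFin p a _)) ⟩
        sumFin p (λ l → M′ i l * P l j) + a * sumFin p (λ l → M″ i l * P l j) ∎)

    ∘·-alternating : ∀ {p} (P : Matrix p n) → Alternating (λ (M : Matrix m p) → D (M · P))
    ∘·-alternating P i k i≢k M Mi≈Mk = D-alt i k i≢k (M · P)
      (λ j → sumFin-cong _ (λ l → *-congʳ (Mi≈Mk l)))

  ∷-alternating : ∀ {m n} {D : Matrix (suc m) n → Carrier} → Alternating D → ∀ u → Alternating (λ M → D (u ∷ M))
  ∷-alternating D-alt u i k i≢k M = D-alt (suc i) (suc k) (i≢k ∘ suc-injective) (u ∷ M)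

  -- The Laplace expansion and its characterisation

  minor : ∀ {n} → Matrix (suc n) (suc n) → Fin (suc n) → Matrix n n
  minor M j a b = M (suc a) (punchIn j b)

  laplaceTerm : ∀ n → Matrix (suc n) (suc n) → Row (suc n)
  laplaceTerm n M j = sign (toℕ j) * (M zero j * det n (minor M j))

  det-cong : ∀ n {M M′ : Matrix n n} → M ≈ᴹ M′ → det n M ≈ det n M′
  det-cong zero    M≈M′ = refl
  det-cong (suc n) {M} {M′} M≈M′ = sumFin-cong (suc n) {laplaceTerm n M} {laplaceTerm n M′} (λ j → *-congˡ
    (*-cong (M≈M′ zero j) (det-cong n (λ a b → M≈M′ (suc a) (punchIn j b)))))

  det-multilinear : ∀ n → Multilinear (det n)
  det-multilinear n .D-cong = det-cong n
  det-multilinear (suc n) .D-linear zero a {M} {M′} {M″} M≈M′ M≈M″ M0 = begin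
    det (suc n) M
      ≈⟨ sumFin-cong (suc n) {laplaceTerm n M} (λ j → begin
           s j * (M zero j * det n (minor M j))
             ≈⟨ *-congˡ (trans (*-congʳ (M0 j)) (distribʳ _ _ _)) ⟩
           s j * (M′ zero j * det n (minor M j) + a * M″ zero j * det n (minor M j))
             ≈⟨ *-congˡ (+-cong (*-congˡ (det-cong n (λ i k → M≈M′ (suc i) (λ ()) (punchIn j k))))
                  (*-congˡ (det-cong n (λ i k → M≈M″ (suc i) (λ ()) (punchIn j k))))) ⟩
           s j * (M′ zero j * det n (minor M′ j) + a * M″ zero j * det n (minor M″ j))
             ≈⟨ trans (distribˡ _ _ _) (+-congˡ (trans (*-congˡ (*-assoc _ _ _)) (x*yz≈y*xz _ _ _))) ⟩
           s j * (M′ zero j * det n (minor M′ j)) + a * (s j * (M″ zero j * det n (minor M″ j))) ∎) ⟩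
    sumFin (suc n) (λ j → laplaceTerm n M′ j + a * laplaceTerm n M″ j)
      ≈⟨ trans (sumFin-+ (suc n) (laplaceTerm n M′) (λ j → a * laplaceTerm n M″ j)) (+-congˡ (sym (*-sumFin (suc n) a (laplaceTerm n M″)))) ⟩
    det (suc n) M′ + a * det (suc n) M″ ∎
    where
    s : Fin (suc n) → Carrier
    s j = sign (toℕ j)
  det-multilinear (suc n) .D-linear (suc i) a {M} {M′} {M″} M≈M′ M≈M″ Mi = begin
    det (suc n) M
      ≈⟨ sumFin-cong (suc n) {laplaceTerm n M} (λ j → begin
           s j * (M zero j * det n (minor M j))
             ≈⟨ *-congˡ (*-congˡ (D-linear (det-multilinear n) i a
                  (λ k k≢i b → M≈M′ (suc k) (k≢i ∘ suc-injective) (punchIn j b))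
                  (λ k k≢i b → M≈M″ (suc k) (k≢i ∘ suc-injective) (punchIn j b))
                  (λ b → Mi (punchIn j b)))) ⟩
           s j * (M zero j * (det n (minor M′ j) + a * det n (minor M″ j)))
             ≈⟨ *-congˡ (trans (distribˡ _ _ _) (+-cong (*-congʳ (M≈M′ zero (λ ()) j))
                  (trans (*-congʳ (M≈M″ zero (λ ()) j)) (x*yz≈y*xz _ _ _)))) ⟩
           s j * (M′ zero j * det n (minor M′ j) + a * (M″ zero j * det n (minor M″ j)))
             ≈⟨ trans (distribˡ _ _ _) (+-congˡ (x*yz≈y*xz _ _ _)) ⟩
           s j * (M′ zero j * det n (minor M′ j)) + a * (s j * (M″ zero j * det n (minor M″ j))) ∎) ⟩
    sumFin (suc n) (λ j → laplaceTerm n M′ j + a * laplaceTerm n M″ j)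
      ≈⟨ trans (sumFin-+ (suc n) (laplaceTerm n M′) (λ j → a * laplaceTerm n M″ j)) (+-congˡ (sym (*-sumFin (suc n) a (laplaceTerm n M″)))) ⟩
    det (suc n) M′ + a * det (suc n) M″ ∎
    where
    s : Fin (suc n) → Carrier
    s j = sign (toℕ j)

  -- The pairs (j , punchIn j k) run over the pairs of distinct columns; the two orders of a pair cancel.
  sumFin-cancel : ∀ n (f : Matrix (suc n) n) →
    (∀ (a b : Fin n) → toℕ a N.≤ toℕ b → f (inject₁ a) b + f (suc b) a ≈ 0#) →
    sumFin (suc n) (λ j → sumFin n (f j)) ≈ 0#
  sumFin-cancel zero    f f≈0 = +-identityˡ 0#
  sumFin-cancel (suc n) f f≈0 = begin
    sumFin (suc n) (f zero) + sumFin (suc n) (λ j → f (suc j) zero + sumFin n (λ k → f (suc j) (suc k)))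
      ≈⟨ +-congˡ (sumFin-+ (suc n) (λ j → f (suc j) zero) (λ j → sumFin n (λ k → f (suc j) (suc k)))) ⟩
    sumFin (suc n) (f zero) + (sumFin (suc n) (λ j → f (suc j) zero) + sumFin (suc n) (λ j → sumFin n (λ k → f (suc j) (suc k))))
      ≈⟨ sym (+-assoc _ _ _) ⟩
    sumFin (suc n) (f zero) + sumFin (suc n) (λ j → f (suc j) zero) + sumFin (suc n) (λ j → sumFin n (λ k → f (suc j) (suc k)))
      ≈⟨ +-cong (trans (sym (sumFin-+ (suc n) (f zero) (λ j → f (suc j) zero))) (sumFin-zero (suc n) (λ b → f≈0 zero b N.z≤n)))
           (sumFin-cancel n (λ j k → f (suc j) (suc k)) (λ a b a≤b → f≈0 (suc a) (suc b) (N.s≤s a≤b))) ⟩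
    0# + 0# ≈⟨ +-identityˡ 0# ⟩
    0# ∎

  -- Expanding along the first two rows gives a sum over ordered pairs of distinct columns.
  -- Exchanging the columns of a pair keeps the remaining minor and, the rows being equal, the
  -- product of entries, but reverses the sign.
  det-rows01 : ∀ n (M : Matrix (suc (suc n)) (suc (suc n))) → M zero ≈ʳ M (suc zero) → det (suc (suc n)) M ≈ 0#
  det-rows01 n M M0≈M1 = trans
    (sumFin-cong (suc (suc n)) {laplaceTerm (suc n) M} (λ j → trans
      (*-congˡ (*-sumFin (suc n) (M zero j) (laplaceTerm n (minor M j))))
      (*-sumFin (suc n) (sign (toℕ j)) (λ k → M zero j * laplaceTerm n (minor M j) k))))
    (sumFin-cancel (suc n) f cancel)
    where
    D : Fin (suc (suc n)) → Fin (suc n) → Carrier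
    D j k = det n (minor (minor M j) k)
    f : Fin (suc (suc n)) → Fin (suc n) → Carrier
    f j k = sign (toℕ j) * (M zero j * (sign (toℕ k) * (M (suc zero) (punchIn j k) * D j k)))
    cancel : ∀ a b → toℕ a N.≤ toℕ b → f (inject₁ a) b + f (suc b) a ≈ 0#
    cancel a b a≤b = begin
      f (inject₁ a) b + f (suc b) a
        ≈⟨ +-cong
             (*-cong (reflexive (≡-cong sign (toℕ-inject₁ a))) (*-congˡ (*-congˡ (*-cong
               (trans (reflexive (≡-cong (M (suc zero)) (punchIn-inject₁-≤ a b a≤b))) (sym (M0≈M1 (suc b))))
               (det-cong n (λ i k → reflexive (≡-cong (M (suc (suc i))) (punchIn-punchIn a b a≤b k))))))))
             (*-congˡ (*-congˡ (*-congˡ (*-congʳ (trans (reflexive (≡-cong (M (suc zero)) (punchIn-suc-≤ a b a≤b))) (sym (M0≈M1 (inject₁ a)))))))) ⟩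
      -- The larger column carries the sign of `suc b` when it is taken first, but that of `b` when
      -- a smaller column has already been deleted; hence the extra `- 1#`.
      sa * (va * (sb * (vb * d))) + (- 1# * sb) * (vb * (sa * (va * d)))
        ≈⟨ +-cong (solve 5 (λ sa va sb vb d → sa :* (va :* (sb :* (vb :* d))) := (sa :* va) :* ((sb :* vb) :* d))
              refl sa va sb vb d)
             (trans (solve 6 (λ m sa va sb vb d → (m :* sb) :* (vb :* (sa :* (va :* d))) := m :* ((sa :* va) :* ((sb :* vb) :* d)))
                   refl (- 1#) sa va sb vb d)
               (-1*x≈-x _)) ⟩
      (sa * va) * ((sb * vb) * d) + - ((sa * va) * ((sb * vb) * d))
        ≈⟨ -‿inverseʳ _ ⟩
      0# ∎
      where
      open ℕ-Solver
      sa = sign (toℕ a)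
      sb = sign (toℕ b)
      va = M zero (inject₁ a)
      vb = M zero (suc b)
      d  = D (suc b) a

  -- Swapping rows `suc k` and 1 places the two equal rows next to each other. The swap leaves the
  -- first row alone, so it happens inside each minor, where the alternating property is already
  -- known.
  det-row0 : ∀ n → Alternating (det (suc n)) → ∀ k (M : Matrix (suc (suc n)) (suc (suc n))) →
    M zero ≈ʳ M (suc k) → det (suc (suc n)) M ≈ 0#
  det-row0 n alt zero M M0≈M1 = det-rows01 n M M0≈M1
  det-row0 n alt k@(suc _) M M0≈Mk = begin
    det (suc (suc n)) M       ≈⟨ sumFin-cong (suc (suc n)) {laplaceTerm (suc n) M} (λ j → begin
      sign (toℕ j) * (M zero j * det (suc n) (minor M j))
        ≈⟨ *-congˡ (*-congˡ (alternating⇒swap (det-multilinear (suc n)) alt zero k (λ ())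
             (minor M′ j) (minor M j) (λ b → sym (M′k (punchIn j b))) (λ _ → refl) (λ r r≢0 r≢k b → sym (M′r r r≢0 r≢k (punchIn j b))))) ⟩
      sign (toℕ j) * (M zero j * - det (suc n) (minor M′ j))
        ≈⟨ trans (*-congˡ (sym (-‿distribʳ-* _ _))) (trans (sym (-‿distribʳ-* _ _)) (sym (-1*x≈-x _))) ⟩
      - 1# * laplaceTerm (suc n) M′ j ∎) ⟩
    sumFin (suc (suc n)) (λ j → - 1# * laplaceTerm (suc n) M′ j) ≈⟨ sym (*-sumFin (suc (suc n)) (- 1#) (laplaceTerm (suc n) M′)) ⟩
    - 1# * det (suc (suc n)) M′ ≈⟨ *-congˡ (det-rows01 n M′ M0≈Mk) ⟩
    - 1# * 0#                 ≈⟨ zeroʳ _ ⟩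
    0#                        ∎
    where
    M′ : Matrix (suc (suc n)) (suc (suc n))
    M′ zero          = M zero
    M′ (suc zero)    = M (suc k)
    M′ (suc r@(suc _)) with r ≟ k
    ... | yes _ = M (suc zero)
    ... | no  _ = M (suc r)
    M′k : M′ (suc k) ≈ʳ M (suc zero)
    M′k j with k ≟ k
    ... | yes _  = refl
    ... | no k≢k = ⊥-elim (k≢k ≡-refl)
    M′r : ∀ r → r ≢ zero → r ≢ k → M′ (suc r) ≈ʳ M (suc r)
    M′r zero      r≢0 r≢k j = ⊥-elim (r≢0 ≡-refl)
    M′r r@(suc _) r≢0 r≢k j with r ≟ k
    ... | yes r≡k = ⊥-elim (r≢k r≡k)
    ... | no _    = refl

  det-alternating : ∀ n → Alternating (det n)
  det-alternating (suc n) zero zero i≢k M _ = ⊥-elim (i≢k ≡-refl)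
  det-alternating (suc n) (suc i) (suc k) i≢k M Mi≈Mk = sumFin-zero (suc n) {laplaceTerm n M} (λ j → trans
    (*-congˡ (trans (*-congˡ (det-alternating n i k (i≢k ∘ ≡-cong suc) (minor M j) (λ b → Mi≈Mk (punchIn j b)))) (zeroʳ _)))
    (zeroʳ _))
  det-alternating (suc (suc n)) zero (suc k) i≢k M M0≈Mk = det-row0 n (det-alternating (suc n)) k M M0≈Mk
  det-alternating (suc (suc n)) (suc i) zero i≢k M Mi≈M0 = det-row0 n (det-alternating (suc n)) i M (λ j → sym (Mi≈M0 j))

  -- These are the rows of the identity with row `j` moved to the front; passing from `j` to the
  -- next index swaps the front row with one other row.
  δ-swap : ∀ n (D : Matrix (suc n) (suc n) → Carrier) → Multilinear D → Alternating D → ∀ j →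
    D (δ j ∷ λ k → δ (punchIn j k)) ≈ sign (toℕ j) * D δ
  δ-swap n D D-ml D-alt = <-weakInduction _ base step
    where
    P : Fin (suc n) → Matrix (suc n) (suc n)
    P j = δ j ∷ λ k → δ (punchIn j k)
    base : D (P zero) ≈ 1# * D δ
    base = trans (D-cong D-ml (λ { zero _ → refl ; (suc _) _ → refl })) (sym (*-identityˡ _))
    step : ∀ j → D (P (inject₁ j)) ≈ sign (toℕ (inject₁ j)) * D δ → D (P (suc j)) ≈ sign (toℕ (suc j)) * D δ
    step j ih = begin
      D (P (suc j))        ≈⟨ alternating⇒swap D-ml D-alt zero (suc j) (λ ()) (P (inject₁ j)) (P (suc j))
                                (λ b → reflexive (≡-cong (λ i → δ i b) (≡-sym (punchIn-inject₁-≡ j))))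
                                (λ b → reflexive (≡-cong (λ i → δ i b) (punchIn-suc-≡ j)))
                                (λ { zero r≢0 _ → ⊥-elim (r≢0 ≡-refl)
                                   ; (suc r) _ r≢j b → reflexive (≡-cong (λ i → δ i b)
                                       (≡-sym (punchIn-inject₁-suc j r (r≢j ∘ ≡-cong suc)))) }) ⟩
      - D (P (inject₁ j))  ≈⟨ -‿cong (trans ih (*-congʳ (reflexive (≡-cong sign (toℕ-inject₁ j))))) ⟩
      - (sign (toℕ j) * D δ) ≈⟨ trans (sym (-1*x≈-x _)) (sym (*-assoc _ _ _)) ⟩
      - 1# * sign (toℕ j) * D δ ∎

  -- Expand the first row in unit vectors. Below a first row `δ j`, column `j` can be cleared, which
  -- leaves a multilinear alternating function of the minor; induction gives the minor's
  -- determinant, and `δ-swap` the Laplace sign.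
  det-unique : ∀ n (D : Matrix n n → Carrier) → Multilinear D → Alternating D → ∀ M → D M ≈ det n M * D δ
  det-unique zero    D D-ml D-alt M = trans (D-cong D-ml (λ ())) (sym (*-identityˡ _))
  det-unique (suc n) D D-ml D-alt M = begin
    D M
      ≈⟨ D-cong D-ml (λ { zero j → sym (δ-sumʳ j (M zero)) ; (suc i) j → refl }) ⟩
    D ((λ j → sumFin (suc n) (λ k → M zero k * δ k j)) ∷ (M ∘ suc))
      ≈⟨ ∷-sum D-ml (suc n) (M zero) δ (M ∘ suc) ⟩
    sumFin (suc n) (λ j → M zero j * D (δ j ∷ (M ∘ suc)))
      ≈⟨ sumFin-cong (suc n) {λ j → M zero j * D (δ j ∷ (M ∘ suc))} (λ j → *-congˡ (term j)) ⟩
    sumFin (suc n) (λ j → M zero j * (det n (minor M j) * (sign (toℕ j) * D δ)))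
      ≈⟨ sumFin-cong (suc n) {λ j → M zero j * (det n (minor M j) * (sign (toℕ j) * D δ))}
            (λ j → solve 4 (λ m d s e → m :* (d :* (s :* e)) := (s :* (m :* d)) :* e)
              refl (M zero j) (det n (minor M j)) (sign (toℕ j)) (D δ)) ⟩
    sumFin (suc n) (λ j → sign (toℕ j) * (M zero j * det n (minor M j)) * D δ)
      ≈⟨ sym (sumFin-* (suc n) (D δ) (laplaceTerm n M)) ⟩
    det (suc n) M * D δ ∎
    where
    open ℕ-Solver
    term : ∀ j → D (δ j ∷ (M ∘ suc)) ≈ det n (minor M j) * (sign (toℕ j) * D δ)
    term j = begin
      D (δ j ∷ (M ∘ suc))
        -- Each lower row is its part off column `j`, a row of the minor embedded by `P`, plus a
        -- multiple of `δ j`.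
        ≈⟨ D-cong D-ml (∷-cong (λ _ → refl) (λ i b → sym (trans (+-comm _ _)
             (trans (sym (sumFin-remove n (λ l → M (suc i) l * δ l b) j)) (δ-sumʳ b (M (suc i))))))) ⟩
      D (δ j ∷ λ i b → (minor M j · P) i b + M (suc i) j * δ j b)
        ≈⟨ add-multiples n Dj-ml (δ j) (λ i N Ni≈δj → D-alt (suc i) zero (λ ()) (δ j ∷ N) Ni≈δj) (λ i → M (suc i) j) (minor M j · P) ⟩
      D (δ j ∷ (minor M j · P))
        ≈⟨ det-unique n (λ N → D (δ j ∷ (N · P))) (∘·-multilinear Dj-ml Dj-alt P) (∘·-alternating Dj-ml Dj-alt P) (minor M j) ⟩
      det n (minor M j) * D (δ j ∷ (δ · P))
        ≈⟨ *-congˡ (D-cong D-ml (∷-cong (λ _ → refl) (λ i b → δ-sumˡ i (λ k → P k b)))) ⟩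
      det n (minor M j) * D (δ j ∷ P)
        ≈⟨ *-congˡ (δ-swap n D D-ml D-alt j) ⟩
      det n (minor M j) * (sign (toℕ j) * D δ) ∎
      where
      P : Matrix n (suc n)
      P k = δ (punchIn j k)
      Dj-ml : Multilinear (λ N → D (δ j ∷ N))
      Dj-ml = ∷-multilinear D-ml (δ j)
      Dj-alt : Alternating (λ N → D (δ j ∷ N))
      Dj-alt = ∷-alternating D-alt (δ j)

  -- For fixed `B` the map sending `A` to `det n (A · B)` is multilinear and alternating, with value
  -- `det n B` at the identity.
  det-· : ∀ n (A B : Matrix n n) → det n (A · B) ≈ det n A * det n B
  det-· n A B = trans
    (det-unique n (λ M → det n (M · B)) (∘·-multilinear ml alt B) (∘·-alternating ml alt B) A)
    (*-congˡ (det-cong n (λ i k → δ-sumˡ i (λ j → B j k))))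
    where
    ml  = det-multilinear n
    alt = det-alternating n

  -- Triangular determinants

  prodFin : ∀ n → Row n → Carrier
  prodFin zero    f = 1#
  prodFin (suc n) f = f zero * prodFin n (f ∘ suc)

  prodFin-cong : ∀ n {f g : Row n} → f ≈ʳ g → prodFin n f ≈ prodFin n g
  prodFin-cong zero    f≈g = refl
  prodFin-cong (suc n) f≈g = *-cong (f≈g zero) (prodFin-cong n (f≈g ∘ suc))

  prodFin-one : ∀ n {f : Row n} → (∀ i → f i ≈ 1#) → prodFin n f ≈ 1#
  prodFin-one zero    f≈1 = refl
  prodFin-one (suc n) f≈1 = trans (*-cong (f≈1 zero) (prodFin-one n (f≈1 ∘ suc))) (*-identityˡ 1#)

  det-zeroColumn : ∀ n {M : Matrix (suc n) (suc n)} → (∀ i → M i zero ≈ 0#) → det (suc n) M ≈ 0#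
  det-zeroColumn n {M} M≈0 = sumFin-zero (suc n) {laplaceTerm n M} (λ
    { zero    → trans (*-congˡ (trans (*-congʳ (M≈0 zero)) (zeroˡ _))) (zeroʳ _)
    ; (suc j) → trans (*-congˡ (trans (*-congˡ (minor≈0 n j M M≈0)) (zeroʳ _))) (zeroʳ _) })
    where
    minor≈0 : ∀ n j (M : Matrix (suc n) (suc n)) → (∀ i → M i zero ≈ 0#) → det n (minor M (suc j)) ≈ 0#
    minor≈0 (suc n) j M M≈0 = det-zeroColumn n {minor M (suc j)} (M≈0 ∘ suc)

  det-head : ∀ n (M : Matrix (suc n) (suc n)) → (∀ j → M zero (suc j) * det n (minor M (suc j)) ≈ 0#) →
    det (suc n) M ≈ M zero zero * det n (minor M zero)
  det-head n M rest≈0 = trans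
    (+-cong (*-identityˡ _) (sumFin-zero n {laplaceTerm n M ∘ suc} (λ j → trans (*-congˡ (rest≈0 j)) (zeroʳ _))))
    (+-identityʳ _)

  det-upper : ∀ n (M : Matrix n n) → (∀ i j → j F.< i → M i j ≈ 0#) → det n M ≈ prodFin n (λ i → M i i)
  det-upper zero    M M≈0 = refl
  det-upper (suc n) M M≈0 = trans
    (det-head n M (λ j → trans (*-congˡ (minor≈0 n M M≈0 j)) (zeroʳ _)))
    (*-congˡ (det-upper n (minor M zero) (λ i j j<i → M≈0 (suc i) (suc j) (N.s≤s j<i))))
    where
    minor≈0 : ∀ n (M : Matrix (suc n) (suc n)) → (∀ i j → j F.< i → M i j ≈ 0#) → ∀ j → det n (minor M (suc j)) ≈ 0#
    minor≈0 (suc n) M M≈0 j = det-zeroColumn n {minor M (suc j)} (λ i → M≈0 (suc i) zero (N.s≤s N.z≤n))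

  det-lower : ∀ n (M : Matrix n n) → (∀ i j → i F.< j → M i j ≈ 0#) → det n M ≈ prodFin n (λ i → M i i)
  det-lower zero    M M≈0 = refl
  det-lower (suc n) M M≈0 = trans
    (det-head n M (λ j → trans (*-congʳ (M≈0 zero (suc j) (N.s≤s N.z≤n))) (zeroˡ _)))
    (*-congˡ (det-lower n (minor M zero) (λ i j i<j → M≈0 (suc i) (suc j) (N.s≤s i<j))))

  -- The determinant of a weighted involution

  module Involution {n} (τ : Fin n → Fin n) (τ-involutive : ∀ i → τ (τ i) ≡ i)
                    (σ : Row n) (σ-τ : ∀ i → σ (τ i) ≈ σ i) (t : Carrier) where

    private
      -- Comparing `i` with `τ i` keeps the entry in column `τ i` on one side of the diagonal, so
      -- that `upper` and `lower` are triangular in the given order of the indices.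
      c⁺ c⁻ : Row n
      c⁺ i = if does (i F.<? τ i) then 1# else 0#
      c⁻ i = if does (τ i F.<? i) then - σ i else 0#

      c⁺-< : ∀ {i} → i F.< τ i → c⁺ i ≈ 1#
      c⁺-< {i} i<τi = reflexive (≡-cong (if_then 1# else 0#) (dec-true (i F.<? τ i) i<τi))

      c⁺-≮ : ∀ {i} → ¬ (i F.< τ i) → c⁺ i ≈ 0#
      c⁺-≮ {i} i≮τi = reflexive (≡-cong (if_then 1# else 0#) (dec-false (i F.<? τ i) i≮τi))

      c⁻-> : ∀ {i} → τ i F.< i → c⁻ i ≈ - σ i
      c⁻-> {i} τi<i = reflexive (≡-cong (if_then - σ i else 0#) (dec-true (τ i F.<? i) τi<i))

      c⁻-≯ : ∀ {i} → ¬ (τ i F.< i) → c⁻ i ≈ 0#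
      c⁻-≯ {i} τi≮i = reflexive (≡-cong (if_then - σ i else 0#) (dec-false (τ i F.<? i) τi≮i))

    twisted : Matrix n n
    twisted i j = t * δ i j + - σ i * δ (τ i) j

    -- The two factors of a two-cycle are distributed over its two indices, which turns the
    -- determinant into a product over single indices.
    weight : Row n
    weight i = if does (τ i F.<? i) then t + σ i else t - σ i

    weight-> : ∀ {i} → τ i F.< i → weight i ≈ t + σ i
    weight-> {i} τi<i = reflexive (≡-cong (if_then t + σ i else (t - σ i)) (dec-true (τ i F.<? i) τi<i))

    weight-≯ : ∀ {i} → ¬ (τ i F.< i) → weight i ≈ t - σ i
    weight-≯ {i} τi≮i = reflexive (≡-cong (if_then t + σ i else (t - σ i)) (dec-false (τ i F.<? i) τi≮i))

    -- On a two-cycle i < τ i the rows of upper are e_i + e_{τ i}, an eigenvector for t − σ i, and e_{τ i},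
    -- an eigenvector for t + σ i modulo the former; hence upper · twisted = lower · upper.
    upper lower : Matrix n n
    upper i j = 1# * δ i j + c⁺ i * δ (τ i) j
    lower i j = weight i * δ i j + c⁻ i * δ (τ i) j

    combine : ∀ {p} a b i k (N : Matrix n p) l →
      sumFin n (λ j → (a * δ i j + b * δ k j) * N j l) ≈ a * N i l + b * N k l
    combine a b i k N l = begin
      sumFin n (λ j → (a * δ i j + b * δ k j) * N j l)
        ≈⟨ sumFin-cong n (λ j → trans (distribʳ _ _ _) (+-cong (*-assoc _ _ _) (*-assoc _ _ _))) ⟩
      sumFin n (λ j → a * (δ i j * N j l) + b * (δ k j * N j l))
        ≈⟨ sumFin-+ n _ _ ⟩
      sumFin n (λ j → a * (δ i j * N j l)) + sumFin n (λ j → b * (δ k j * N j l))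
        ≈⟨ sym (+-cong (*-sumFin n a _) (*-sumFin n b _)) ⟩
      a * sumFin n (λ j → δ i j * N j l) + b * sumFin n (λ j → δ k j * N j l)
        ≈⟨ +-cong (*-congˡ (δ-sumˡ i (λ j → N j l))) (*-congˡ (δ-sumˡ k (λ j → N j l))) ⟩
      a * N i l + b * N k l ∎

    upper-< : ∀ {i} → i F.< τ i → ∀ k → upper i k ≈ δ i k + δ (τ i) k
    upper-< i<τi k = +-cong (*-identityˡ _) (trans (*-congʳ (c⁺-< i<τi)) (*-identityˡ _))

    upper-≮ : ∀ {i} → ¬ (i F.< τ i) → ∀ k → upper i k ≈ δ i k
    upper-≮ i≮τi k = trans (+-cong (*-identityˡ _) (trans (*-congʳ (c⁺-≮ i≮τi)) (zeroˡ _))) (+-identityʳ _)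

    twisted-τ : ∀ i k → twisted (τ i) k ≈ t * δ (τ i) k + - σ i * δ i k
    twisted-τ i k = +-congˡ (*-cong (-‿cong (σ-τ i)) (reflexive (≡-cong (λ r → δ r k) (τ-involutive i))))

    intertwine : upper · twisted ≈ᴹ lower · upper
    intertwine i k = trans (combine 1# (c⁺ i) i (τ i) twisted k)
      (trans (cases (<-cmp i (τ i))) (sym (combine (weight i) (c⁻ i) i (τ i) upper k)))
      where
      open ℕ-Solver
      u = δ i k
      v = δ (τ i) k
      s = σ i
      cases : Tri (i F.< τ i) (i ≡ τ i) (τ i F.< i) →
        1# * twisted i k + c⁺ i * twisted (τ i) k ≈ weight i * upper i k + c⁻ i * upper (τ i) k
      cases (tri< i<τi _ τi≮i) = begin
        1# * (t * u + - s * v) + c⁺ i * twisted (τ i) k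
          ≈⟨ +-congˡ (*-cong (c⁺-< i<τi) (twisted-τ i k)) ⟩
        1# * (t * u + - s * v) + 1# * (t * v + - s * u)
          ≈⟨ solve 5 (λ t n u v w → con 1 :* (t :* u :+ n :* v) :+ con 1 :* (t :* v :+ n :* u) := (t :+ n) :* (u :+ v) :+ con 0 :* w)
                refl t (- s) u v (upper (τ i) k) ⟩
        (t - s) * (u + v) + 0# * upper (τ i) k
          ≈⟨ sym (+-cong (*-cong (weight-≯ τi≮i) (upper-< i<τi k)) (*-congʳ (c⁻-≯ τi≮i))) ⟩
        weight i * upper i k + c⁻ i * upper (τ i) k ∎
      cases (tri≈ i≮τi i≡τi τi≮i) = begin
        1# * (t * u + - s * v) + c⁺ i * twisted (τ i) k
          ≈⟨ +-cong (*-congˡ (+-congˡ (*-congˡ (reflexive (≡-cong (λ r → δ r k) (≡-sym i≡τi)))))) (*-congʳ (c⁺-≮ i≮τi)) ⟩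
        1# * (t * u + - s * u) + 0# * twisted (τ i) k
          ≈⟨ solve 5 (λ t n u w w′ → con 1 :* (t :* u :+ n :* u) :+ con 0 :* w := (t :+ n) :* u :+ con 0 :* w′)
                refl t (- s) u (twisted (τ i) k) (upper (τ i) k) ⟩
        (t - s) * u + 0# * upper (τ i) k
          ≈⟨ sym (+-cong (*-cong (weight-≯ τi≮i) (upper-≮ i≮τi k)) (*-congʳ (c⁻-≯ τi≮i))) ⟩
        weight i * upper i k + c⁻ i * upper (τ i) k ∎
      cases (tri> i≮τi _ τi<i) = begin
        1# * (t * u + - s * v) + c⁺ i * twisted (τ i) k
          ≈⟨ +-cong (*-identityˡ _) (trans (*-congʳ (c⁺-≮ i≮τi)) (zeroˡ _)) ⟩
        (t * u + - s * v) + 0#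
          -- The zero term `(s - s) * u` completes `v` to `v + u`, the row of `upper` at `τ i`, and
          -- `t` to `t + s`.
          ≈⟨ +-congˡ (sym (trans (*-congʳ (-‿inverseʳ s)) (zeroˡ u))) ⟩
        (t * u + - s * v) + (s + - s) * u
          ≈⟨ solve 5 (λ t s n u v → (t :* u :+ n :* v) :+ (s :+ n) :* u := (t :+ s) :* u :+ n :* (v :+ u))
                refl t s (- s) u v ⟩
        (t + s) * u + - s * (v + u)
          ≈⟨ +-congˡ (*-congˡ (+-congˡ (reflexive (≡-cong (λ r → δ r k) (≡-sym (τ-involutive i)))))) ⟩
        (t + s) * u + - s * (v + δ (τ (τ i)) k)
          ≈⟨ sym (+-cong (*-cong (weight-> τi<i) (upper-≮ i≮τi k))
               (*-cong (c⁻-> τi<i) (upper-< (≡-subst (τ i F.<_) (≡-sym (τ-involutive i)) τi<i) k))) ⟩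
        weight i * upper i k + c⁻ i * upper (τ i) k ∎

    det-upper≈1 : det n upper ≈ 1#
    det-upper≈1 = trans (det-upper n upper below) (prodFin-one n diagonal)
      where
      below : ∀ i j → j F.< i → upper i j ≈ 0#
      below i j j<i with i F.<? τ i
      ... | yes i<τi = trans (+-cong (trans (*-congˡ (δ-off (≢-sym (<⇒≢ j<i)))) (zeroʳ _))
              (trans (*-congˡ (δ-off (≢-sym (<⇒≢ (N.<-trans j<i i<τi))))) (zeroʳ _))) (+-identityˡ 0#)
      ... | no i≮τi  = trans (upper-≮ i≮τi j) (δ-off (≢-sym (<⇒≢ j<i)))
      diagonal : ∀ i → upper i i ≈ 1#
      diagonal i with i F.<? τ i
      ... | yes i<τi = trans (+-cong (trans (*-identityˡ _) (δ-diag i)) (trans (*-congˡ (δ-off (≢-sym (<⇒≢ i<τi)))) (zeroʳ _))) (+-identityʳ 1#)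
      ... | no i≮τi  = trans (upper-≮ i≮τi i) (δ-diag i)

    det-lower≈weights : det n lower ≈ prodFin n weight
    det-lower≈weights = trans (det-lower n lower above) (prodFin-cong n diagonal)
      where
      error≈0 : ∀ i j → i F.≤ j → c⁻ i * δ (τ i) j ≈ 0#
      error≈0 i j i≤j with τ i F.<? i
      ... | yes τi<i = trans (*-congˡ (δ-off (<⇒≢ (N.<-≤-trans τi<i i≤j)))) (zeroʳ _)
      ... | no τi≮i  = trans (*-congʳ (c⁻-≯ τi≮i)) (zeroˡ _)
      above : ∀ i j → i F.< j → lower i j ≈ 0#
      above i j i<j = trans (+-cong (trans (*-congˡ (δ-off (<⇒≢ i<j))) (zeroʳ _)) (error≈0 i j (N.<⇒≤ i<j))) (+-identityˡ 0#)
      diagonal : ∀ i → lower i i ≈ weight i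
      diagonal i = trans (+-cong (trans (*-congˡ (δ-diag i)) (*-identityʳ _)) (error≈0 i i N.≤-refl)) (+-identityʳ _)

    det-twisted : det n twisted ≈ prodFin n weight
    det-twisted = begin
      det n twisted               ≈⟨ sym (trans (*-congʳ det-upper≈1) (*-identityˡ _)) ⟩
      det n upper * det n twisted ≈⟨ sym (det-· n upper twisted) ⟩
      det n (upper · twisted)     ≈⟨ det-cong n intertwine ⟩
      det n (lower · upper)       ≈⟨ det-· n lower upper ⟩
      det n lower * det n upper   ≈⟨ trans (*-congˡ det-upper≈1) (*-identityʳ _) ⟩
      det n lower                 ≈⟨ det-lower≈weights ⟩
      prodFin n weight            ∎

-- Roots of unity

module PowersAndSums {c ℓ : Level} (R : CommutativeRing c ℓ) where
  open CommutativeRing R hiding (zero)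
  open RingDefs R
  open Determinant R
  open import Relation.Binary.Reasoning.Setoid setoid

  Nontrivial : Set ℓ
  Nontrivial = ¬ (1# ≈ 0#)

  NoZeroDivisors : Set (c Level.⊔ ℓ)
  NoZeroDivisors = ∀ a b → a * b ≈ 0# → (a ≈ 0#) ⊎ (b ≈ 0#)

  pow-+ : ∀ a m n → pow a (m N.+ n) ≈ pow a m * pow a n
  pow-+ a zero    n = sym (*-identityˡ _)
  pow-+ a (suc m) n = trans (*-congˡ (pow-+ a m n)) (sym (*-assoc _ _ _))

  pow-cong : ∀ {a b} n → a ≈ b → pow a n ≈ pow b n
  pow-cong zero    a≈b = refl
  pow-cong (suc n) a≈b = *-cong a≈b (pow-cong n a≈b)

  pow-1# : ∀ n → pow 1# n ≈ 1#
  pow-1# zero    = refl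
  pow-1# (suc n) = trans (*-identityˡ _) (pow-1# n)

  pow-* : ∀ a m n → pow a (m N.* n) ≈ pow (pow a n) m
  pow-* a zero    n = refl
  pow-* a (suc m) n = trans (pow-+ a n (m N.* n)) (*-congˡ (pow-* a m n))

  pow-commute : ∀ a m n → pow (pow a m) n ≈ pow (pow a n) m
  pow-commute a m n = trans (sym (pow-* a n m)) (trans (reflexive (≡-cong (pow a) (N.*-comm n m))) (pow-* a m n))

  sumR-cong : ∀ n {f g : ℕ → Carrier} → (∀ k → 1 ≤ k → k ≤ n → f k ≈ g k) → sumR n f ≈ sumR n g
  sumR-cong zero    f≈g = refl
  sumR-cong (suc n) f≈g = +-cong (f≈g (suc n) (s≤s z≤n) N.≤-refl)
    (sumR-cong n (λ k 1≤k k≤n → f≈g k 1≤k (N.m≤n⇒m≤1+n k≤n)))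

  sumR-zero : ∀ n {f : ℕ → Carrier} → (∀ k → 1 ≤ k → k ≤ n → f k ≈ 0#) → sumR n f ≈ 0#
  sumR-zero zero    f≈0 = refl
  sumR-zero (suc n) f≈0 = trans (+-cong (f≈0 (suc n) (s≤s z≤n) N.≤-refl)
    (sumR-zero n (λ k 1≤k k≤n → f≈0 k 1≤k (N.m≤n⇒m≤1+n k≤n)))) (+-identityˡ 0#)

  sumR-single : ∀ n {f : ℕ → Carrier} k₀ → 1 ≤ k₀ → k₀ ≤ n →
    (∀ k → 1 ≤ k → k ≤ n → k ≢ k₀ → f k ≈ 0#) → sumR n f ≈ f k₀
  sumR-single zero    k₀ 1≤k₀ k₀≤0 f≈0 = ⊥-elim (N.<⇒≱ 1≤k₀ k₀≤0)
  sumR-single (suc n) k₀ 1≤k₀ k₀≤n f≈0 with k₀ N.≟ suc n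
  ... | yes ≡-refl = trans (+-congˡ (sumR-zero n (λ k 1≤k k≤n → f≈0 k 1≤k (N.m≤n⇒m≤1+n k≤n) (N.<⇒≢ (s≤s k≤n))))) (+-identityʳ _)
  ... | no k₀≢     = trans (+-cong (f≈0 (suc n) (s≤s z≤n) N.≤-refl (≢-sym k₀≢))
    (sumR-single n k₀ 1≤k₀ (N.s≤s⁻¹ (N.≤∧≢⇒< k₀≤n k₀≢)) (λ k 1≤k k≤n → f≈0 k 1≤k (N.m≤n⇒m≤1+n k≤n)))) (+-identityˡ _)

  sumFin-sumR : ∀ n m (f : Fin n → ℕ → Carrier) (b : Fin n → Carrier) →
    sumFin n (λ j → sumR m (f j) * b j) ≈ sumR m (λ k → sumFin n (λ j → f j k * b j))
  sumFin-sumR n zero    f b = sumFin-zero n (λ j → zeroˡ _)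
  sumFin-sumR n (suc m) f b = trans
    (trans (sumFin-cong n (λ j → distribʳ _ _ _)) (sumFin-+ n _ _))
    (+-congˡ (sumFin-sumR n m f b))

  sumFin-one : ∀ n {f : Fin n → Carrier} → (∀ j → f j ≈ 1#) → sumFin n f ≈ fromℕ n
  sumFin-one zero    f≈1 = refl
  sumFin-one (suc n) f≈1 = +-cong (f≈1 zero) (sumFin-one n (f≈1 ∘ suc))

  -- Both sides are the sum of the powers of `z` with exponents 1,...,n+1, once with the first and
  -- once with the last power split off.
  geometric : ∀ z n → z * sumFin n (λ j → pow z (suc (toℕ j))) + z ≈ sumFin n (λ j → pow z (suc (toℕ j))) + z * pow z n
  geometric z zero    = +-cong (zeroʳ z) (sym (*-identityʳ z))
  geometric z (suc n) = begin
    z * S (suc n) + z             ≈⟨ +-congʳ (*-congˡ S-suc) ⟩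
    z * (S n + z * pow z n) + z   ≈⟨ +-congʳ (distribˡ _ _ _) ⟩
    z * S n + z * (z * pow z n) + z ≈⟨ +-assoc _ _ _ ⟩
    z * S n + (z * (z * pow z n) + z) ≈⟨ +-congˡ (+-comm _ _) ⟩
    z * S n + (z + z * (z * pow z n)) ≈⟨ sym (+-assoc _ _ _) ⟩
    z * S n + z + z * (z * pow z n) ≈⟨ +-congʳ (geometric z n) ⟩
    S n + z * pow z n + z * (z * pow z n) ≈⟨ +-congʳ (sym S-suc) ⟩
    S (suc n) + z * (z * pow z n) ∎
    where
    S : ℕ → Carrier
    S n = sumFin n (λ j → pow z (suc (toℕ j)))
    -- `sumFin` splits off the first power; the identity for `n` converts this into splitting off
    -- the last.
    S-suc : S (suc n) ≈ S n + z * pow z n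
    S-suc = begin
      z * 1# + sumFin n (λ j → z * pow z (suc (toℕ j))) ≈⟨ +-cong (*-identityʳ z) (sym (*-sumFin n z _)) ⟩
      z + z * S n             ≈⟨ +-comm _ _ ⟩
      z * S n + z             ≈⟨ geometric z n ⟩
      S n + z * pow z n       ∎

-- Independence of powers in a domain

module Domain {c ℓ : Level} (R : CommutativeRing c ℓ)
  (1≉0 : PowersAndSums.Nontrivial R) (domain : PowersAndSums.NoZeroDivisors R) where
  open CommutativeRing R hiding (zero)
  open RingDefs R
  open Determinant R
  open PowersAndSums R
  open import Algebra.Properties.Ring ring
  open import Algebra.Properties.Group +-group using () renaming (x∙y⁻¹≈ε⇒x≈y to x-y≈0⇒x≈y)
  open import Relation.Binary.Reasoning.Setoid setoid

  *-nonzero : ∀ {a b} → ¬ (a ≈ 0#) → ¬ (b ≈ 0#) → ¬ (a * b ≈ 0#)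
  *-nonzero a≉0 b≉0 ab≈0 with domain _ _ ab≈0
  ... | inj₁ a≈0 = a≉0 a≈0
  ... | inj₂ b≈0 = b≉0 b≈0

  *-cancelʳ : ∀ {a b d} → ¬ (d ≈ 0#) → a * d ≈ b * d → a ≈ b
  *-cancelʳ {a} {b} {d} d≉0 ad≈bd with domain (a - b) d (begin
    (a - b) * d       ≈⟨ distribʳ d a (- b) ⟩
    a * d + - b * d   ≈⟨ +-cong ad≈bd (sym (-‿distribˡ-* b d)) ⟩
    b * d - b * d     ≈⟨ -‿inverseʳ _ ⟩
    0#                ∎)
  ... | inj₁ a-b≈0 = x-y≈0⇒x≈y a b a-b≈0
  ... | inj₂ d≈0   = ⊥-elim (d≉0 d≈0)

  -- Eliminating the first node replaces the coefficients c j by c j (a j − a 0).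
  powers-independent : ∀ n (a d : Row n) → (∀ i j → i ≢ j → ¬ (a i ≈ a j)) →
    (∀ m → sumFin n (λ j → d j * pow (a j) m) ≈ 0#) → ∀ j → d j ≈ 0#
  powers-independent (suc n) a d distinct vanish = λ { zero → head≈0 ; (suc j) → tail≈0 j }
    where
    d′ : Row (suc n)
    d′ j = d j * (a j - a zero)
    vanish′ : ∀ m → sumFin n (λ j → d′ (suc j) * pow (a (suc j)) m) ≈ 0#
    vanish′ m = begin
      sumFin n (λ j → d′ (suc j) * pow (a (suc j)) m)
        ≈⟨ sym (trans (+-congʳ (trans (*-congʳ (trans (*-congˡ (-‿inverseʳ (a zero))) (zeroʳ _))) (zeroˡ _))) (+-identityˡ _)) ⟩
      sumFin (suc n) (λ j → d′ j * pow (a j) m)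
        ≈⟨ sumFin-cong (suc n) {λ j → d′ j * pow (a j) m} {λ j → d j * pow (a j) (suc m) + - a zero * (d j * pow (a j) m)} (λ j →
             solve 4 (λ d a n p → (d :* (a :+ n)) :* p := d :* (a :* p) :+ n :* (d :* p))
                   refl (d j) (a j) (- a zero) (pow (a j) m)) ⟩
      sumFin (suc n) (λ j → d j * pow (a j) (suc m) + - a zero * (d j * pow (a j) m))
        ≈⟨ sumFin-+ (suc n) (λ j → d j * pow (a j) (suc m)) (λ j → - a zero * (d j * pow (a j) m)) ⟩
      sumFin (suc n) (λ j → d j * pow (a j) (suc m)) + sumFin (suc n) (λ j → - a zero * (d j * pow (a j) m))
        ≈⟨ +-cong (vanish (suc m)) (trans (sym (*-sumFin (suc n) (- a zero) (λ j → d j * pow (a j) m))) (trans (*-congˡ (vanish m)) (zeroʳ _))) ⟩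
      0# + 0# ≈⟨ +-identityˡ 0# ⟩
      0#      ∎
      where open ℕ-Solver
    tail≈0 : ∀ j → d (suc j) ≈ 0#
    tail≈0 j with domain _ _ (powers-independent n (a ∘ suc) (d′ ∘ suc) (λ i k i≢k → distinct (suc i) (suc k) (i≢k ∘ suc-injective)) vanish′ j)
    ... | inj₁ d≈0 = d≈0
    ... | inj₂ a≈a = ⊥-elim (distinct (suc j) zero (λ ()) (x-y≈0⇒x≈y _ _ a≈a))
    head≈0 : d zero ≈ 0#
    head≈0 = begin
      d zero           ≈⟨ sym (trans (+-identityʳ _) (*-identityʳ _)) ⟩
      d zero * 1# + 0# ≈⟨ +-congˡ (sym (sumFin-zero n (λ j → trans (*-congʳ (tail≈0 j)) (zeroˡ _)))) ⟩
      d zero * 1# + sumFin n (λ j → d (suc j) * pow (a (suc j)) 0) ≈⟨ vanish 0 ⟩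
      0#               ∎

  -- Orthogonality and the Fourier matrix

  module PrimitiveRoot (x : ℕ) {{x≢0 : NonZero x}} (ζ : Carrier) (ζˣ≈1 : pow ζ x ≈ 1#)
    (order≥x : ∀ d → 0 < d → d < x → ¬ (pow ζ d ≈ 1#)) where

    X : Carrier
    X = fromℕ x

    ∣⇒pow≈1 : ∀ {a} → x ∣ a → pow ζ a ≈ 1#
    ∣⇒pow≈1 (divides k ≡-refl) = trans (pow-* ζ k x) (trans (pow-cong k ζˣ≈1) (pow-1# k))

    -- The remainder of `a` modulo `x` is again an exponent giving 1, and being below the order of
    -- `ζ` it must be 0.
    pow≈1⇒∣ : ∀ {a} → pow ζ a ≈ 1# → x ∣ a
    pow≈1⇒∣ {a} ζᵃ≈1 with a N.% x N.≟ 0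
    ... | yes r≡0 = m%n≡0⇒n∣m a x r≡0
    ... | no r≢0  = ⊥-elim (order≥x (a N.% x) (N.n≢0⇒n>0 r≢0) (m%n<n a x) (begin
      pow ζ (a N.% x)                               ≈⟨ sym (trans (*-congˡ (∣⇒pow≈1 (divides (a / x) ≡-refl))) (*-identityʳ _)) ⟩
      pow ζ (a N.% x) * pow ζ (a / x N.* x)         ≈⟨ sym (pow-+ ζ (a N.% x) _) ⟩
      pow ζ (a N.% x N.+ a / x N.* x)               ≈⟨ reflexive (≡-cong (pow ζ) (≡-sym (m≡m%n+[m/n]*n a x))) ⟩
      pow ζ a                                       ≈⟨ ζᵃ≈1 ⟩
      1#                                            ∎))

    pow≉0 : ∀ k → k ≤ x → ¬ (pow ζ k ≈ 0#)
    pow≉0 k k≤x ζᵏ≈0 = 1≉0 (begin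
      1#                          ≈⟨ sym ζˣ≈1 ⟩
      pow ζ x                     ≈⟨ reflexive (≡-cong (pow ζ) (≡-sym (N.m+[n∸m]≡n k≤x))) ⟩
      pow ζ (k N.+ (x ∸ k))       ≈⟨ pow-+ ζ k (x ∸ k) ⟩
      pow ζ k * pow ζ (x ∸ k)     ≈⟨ trans (*-congʳ ζᵏ≈0) (zeroˡ _) ⟩
      0#                          ∎)

    orthogonal-∣ : ∀ a → x ∣ a → sumFin x (λ j → pow ζ (suc (toℕ j) N.* a)) ≈ X
    orthogonal-∣ a x∣a = sumFin-one x (λ j → trans (pow-* ζ (suc (toℕ j)) a)
      (trans (pow-cong (suc (toℕ j)) (∣⇒pow≈1 x∣a)) (pow-1# (suc (toℕ j)))))

    -- With `z = pow ζ a`, the geometric identity and `pow z x ≈ 1#` give `(z - 1#) * S ≈ 0#`; since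
    -- `z` is not 1, the sum vanishes.
    orthogonal-∤ : ∀ a → ¬ (x ∣ a) → sumFin x (λ j → pow ζ (suc (toℕ j) N.* a)) ≈ 0#
    orthogonal-∤ a x∤a = trans (sumFin-cong x (λ j → pow-* ζ (suc (toℕ j)) a)) S≈0
      where
      z S : Carrier
      z = pow ζ a
      S = sumFin x (λ j → pow z (suc (toℕ j)))
      zS≈S : z * S + z ≈ S + z
      zS≈S = trans (geometric z x) (+-congˡ (trans (*-congˡ (trans (pow-commute ζ a x) (trans (pow-cong a ζˣ≈1) (pow-1# a)))) (*-identityʳ z)))
      S≈0 : S ≈ 0#
      S≈0 with domain (z - 1#) S (begin
        (z - 1#) * S          ≈⟨ distribʳ S z (- 1#) ⟩
        z * S + - 1# * S      ≈⟨ +-cong (+-cancelʳ z (z * S) S zS≈S) (-1*x≈-x S) ⟩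
        S - S                 ≈⟨ -‿inverseʳ S ⟩
        0#                    ∎)
      ... | inj₁ z-1≈0 = ⊥-elim (x∤a (pow≈1⇒∣ (x-y≈0⇒x≈y z 1# z-1≈0)))
      ... | inj₂ S≈0   = S≈0

    nodes-distinct< : ∀ i j → toℕ i < toℕ j → ¬ (pow ζ (suc (toℕ {x} i)) ≈ pow ζ (suc (toℕ {x} j)))
    nodes-distinct< i j i<j eq = order≥x (toℕ j ∸ toℕ i) (N.m<n⇒0<n∸m i<j)
      (N.≤-<-trans (N.m∸n≤m (toℕ j) (toℕ i)) (toℕ<n j))
      (*-cancelʳ (pow≉0 (suc (toℕ i)) (toℕ<n i)) (begin
        pow ζ (toℕ j ∸ toℕ i) * pow ζ (suc (toℕ i)) ≈⟨ sym (pow-+ ζ (toℕ j ∸ toℕ i) (suc (toℕ i))) ⟩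
        pow ζ (toℕ j ∸ toℕ i N.+ suc (toℕ i))       ≈⟨ reflexive (≡-cong (pow ζ) (≡-trans (N.+-suc _ (toℕ i)) (≡-cong suc (N.m∸n+n≡m (N.<⇒≤ i<j))))) ⟩
        pow ζ (suc (toℕ j))                         ≈⟨ sym eq ⟩
        pow ζ (suc (toℕ i))                         ≈⟨ sym (*-identityˡ _) ⟩
        1# * pow ζ (suc (toℕ i))                    ∎))

    nodes-distinct : ∀ i j → i ≢ j → ¬ (pow ζ (suc (toℕ {x} i)) ≈ pow ζ (suc (toℕ {x} j)))
    nodes-distinct i j i≢j eq with N.<-cmp (toℕ i) (toℕ j)
    ... | tri< i<j _ _ = nodes-distinct< i j i<j eq
    ... | tri≈ _ i≡j _ = i≢j (toℕ-injective i≡j)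
    ... | tri> _ _ j<i = nodes-distinct< j i j<i (sym eq)

    -- If x were 0 in R, all power sums of the x distinct roots of unity would vanish.
    X≉0 : ¬ (X ≈ 0#)
    X≉0 X≈0 = 1≉0 (powers-independent x (λ j → pow ζ (suc (toℕ j))) (λ _ → 1#) nodes-distinct vanish
                    (fromℕ< (N.>-nonZero⁻¹ x)))
      where
      power-sum : ∀ m → sumFin x (λ j → pow ζ (suc (toℕ j) N.* m)) ≈ 0#
      power-sum m with x ∣? m
      ... | yes x∣m = trans (orthogonal-∣ m x∣m) X≈0
      ... | no x∤m  = orthogonal-∤ m x∤m
      vanish : ∀ m → sumFin x (λ j → 1# * pow (pow ζ (suc (toℕ j))) m) ≈ 0#
      vanish m = trans (sumFin-cong x (λ j → trans (*-identityˡ _)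
        (trans (pow-commute ζ (suc (toℕ j)) m) (sym (pow-* ζ (suc (toℕ j)) m))))) (power-sum m)

    -- The exponent `x ∸ k` stands for `-k`, avoiding negative powers of `ζ`. The second matrix
    -- inverts the first only up to the factor `X`.
    fourier fourier⁻¹ : Matrix x x
    fourier i j = pow ζ (suc (toℕ i) N.* suc (toℕ j))
    fourier⁻¹ j k = pow ζ (suc (toℕ j) N.* (x ∸ suc (toℕ k)))

    fourier-inverse : fourier · fourier⁻¹ ≈ᴹ (λ i j → X * δ i j)
    fourier-inverse i k = trans (sumFin-cong x (λ j → begin
      pow ζ (î N.* suc (toℕ j)) * pow ζ (suc (toℕ j) N.* (x ∸ k̂)) ≈⟨ sym (pow-+ ζ (î N.* suc (toℕ j)) _) ⟩
      pow ζ (î N.* suc (toℕ j) N.+ suc (toℕ j) N.* (x ∸ k̂))       ≈⟨ reflexive (≡-cong (pow ζ) (≡-trans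
           (≡-cong (N._+ suc (toℕ j) N.* (x ∸ k̂)) (N.*-comm î (suc (toℕ j))))
           (≡-sym (N.*-distribˡ-+ (suc (toℕ j)) î (x ∸ k̂))))) ⟩
      pow ζ (suc (toℕ j) N.* (î N.+ (x ∸ k̂)))                     ∎)) sum-value
      where
      î k̂ : ℕ
      î = suc (toℕ i)
      k̂ = suc (toℕ k)
      k̂≤x : k̂ ≤ x
      k̂≤x = toℕ<n k
      -- The number `î + (x ∸ k̂)` lies strictly between 0 and 2x, so it can be a multiple of `x`
      -- only by being `x`.
      x∤ : i ≢ k → ¬ (x ∣ î N.+ (x ∸ k̂))
      x∤ i≢k x∣ with N.<-cmp (toℕ i) (toℕ k)
      ... | tri< i<k _ _ = N.<⇒≱ (≡-subst (î N.+ (x ∸ k̂) <_) (N.m+[n∸m]≡n k̂≤x) (N.+-monoˡ-< (x ∸ k̂) (s≤s i<k))) (∣⇒≤ x∣)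
      ... | tri≈ _ i≡k _ = i≢k (toℕ-injective i≡k)
      ... | tri> _ _ k<i = N.<⇒≱ (N.≤-<-trans (N.m∸n≤m (toℕ i) (toℕ k)) (toℕ<n i))
        (∣⇒≤ {{N.>-nonZero (N.m<n⇒0<n∸m k<i)}} (∣m+n∣m⇒∣n (≡-subst (x ∣_) eq x∣) ∣-refl))
        where
        eq : î N.+ (x ∸ k̂) ≡ x N.+ (toℕ i ∸ toℕ k)
        eq = ≡-trans (≡-cong (N._+ (x ∸ k̂)) (≡-sym (N.m∸n+n≡m (N.<⇒≤ (s≤s k<i)))))
          (≡-trans (N.+-assoc (î ∸ k̂) k̂ (x ∸ k̂)) (≡-trans (≡-cong (î ∸ k̂ N.+_) (N.m+[n∸m]≡n k̂≤x)) (N.+-comm (î ∸ k̂) x)))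
      sum-value : sumFin x (λ j → pow ζ (suc (toℕ j) N.* (î N.+ (x ∸ k̂)))) ≈ X * δ i k
      sum-value with i ≟ k
      ... | yes ≡-refl = trans (orthogonal-∣ _ (≡-subst (x ∣_) (≡-sym (N.m+[n∸m]≡n k̂≤x)) ∣-refl))
        (sym (trans (*-congˡ (δ-diag i)) (*-identityʳ X)))
      ... | no i≢k = trans (orthogonal-∤ _ (x∤ i≢k)) (sym (trans (*-congˡ (δ-off i≢k)) (zeroʳ X)))

    prodFin≉0 : ∀ n {f : Row n} → (∀ i → ¬ (f i ≈ 0#)) → ¬ (prodFin n f ≈ 0#)
    prodFin≉0 zero    f≉0 = 1≉0
    prodFin≉0 (suc n) f≉0 = *-nonzero (f≉0 zero) (prodFin≉0 n (f≉0 ∘ suc))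

    det-fourier≉0 : ¬ (det x fourier ≈ 0#)
    det-fourier≉0 detF≈0 = prodFin≉0 x {λ i → X * δ i i} (λ i Xδ≈0 → X≉0 (trans (sym (trans (*-congˡ (δ-diag i)) (*-identityʳ X))) Xδ≈0)) (begin
      prodFin x (λ i → X * δ i i)
        ≈⟨ sym (det-lower x _ (λ i j i<j → trans (*-congˡ (δ-off {i = i} {j} (λ { ≡-refl → N.<-irrefl ≡-refl i<j }))) (zeroʳ X))) ⟩
      det x (λ i j → X * δ i j)           ≈⟨ sym (det-cong x fourier-inverse) ⟩
      det x (fourier · fourier⁻¹)         ≈⟨ det-· x fourier fourier⁻¹ ⟩
      det x fourier * det x fourier⁻¹     ≈⟨ trans (*-congʳ detF≈0) (zeroˡ _) ⟩
      0#                                  ∎)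

    -- Kloosterman sums against exponentials

    module Kloosterman (Q : ℕ) (∣x : ∀ q → 1 ≤ q → q ≤ Q → q ∣ x) where
      open Farey Q x
      open ℕ-Solver using (solve; _:=_; _:*_; _:+_; con)

      coprime-term : ∀ (m n p k : ℕ) → Carrier
      coprime-term m n p k = if coprimeᵇ k (suc p) then pow ζ ((x / suc p) N.* (m N.* k N.+ n N.* inv p k)) else 0#

      column-sum : ∀ (m a p k : ℕ) → Carrier
      column-sum m a p k = sumFin x (λ j → coprime-term m (suc (toℕ j)) p k * pow ζ (suc (toℕ j) N.* a))

      -- The part of the exponent free of the column index factors out; the rest is a full
      -- exponential sum of frequency `g * inv p k + a`, ready for orthogonality.
      column-sum-coprime : ∀ m a p k → gcd k (suc p) ≡ 1 → column-sum m a p k ≈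
        pow ζ (m N.* (x / suc p N.* k)) * sumFin x (λ j → pow ζ (suc (toℕ j) N.* (x / suc p N.* inv p k N.+ a)))
      column-sum-coprime m a p k k⊥q = trans (sumFin-cong x term) (sym (*-sumFin x _ _))
        where
        g = x / suc p
        term : ∀ j → coprime-term m (suc (toℕ j)) p k * pow ζ (suc (toℕ j) N.* a)
          ≈ pow ζ (m N.* (g N.* k)) * pow ζ (suc (toℕ j) N.* (g N.* inv p k N.+ a))
        term j = begin
          coprime-term m ĵ p k * pow ζ (ĵ N.* a)
            ≈⟨ *-congʳ (reflexive (≡-cong (if_then pow ζ (g N.* (m N.* k N.+ ĵ N.* inv p k)) else 0#) (dec-true (gcd k (suc p) N.≟ 1) k⊥q))) ⟩
          pow ζ (g N.* (m N.* k N.+ ĵ N.* inv p k)) * pow ζ (ĵ N.* a)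
            ≈⟨ sym (pow-+ ζ (g N.* (m N.* k N.+ ĵ N.* inv p k)) (ĵ N.* a)) ⟩
          pow ζ (g N.* (m N.* k N.+ ĵ N.* inv p k) N.+ ĵ N.* a)
            ≈⟨ reflexive (≡-cong (pow ζ) (exponents g m k ĵ (inv p k) a)) ⟩
          pow ζ (m N.* (g N.* k) N.+ ĵ N.* (g N.* inv p k N.+ a))
            ≈⟨ pow-+ ζ (m N.* (g N.* k)) _ ⟩
          pow ζ (m N.* (g N.* k)) * pow ζ (ĵ N.* (g N.* inv p k N.+ a)) ∎
          where
          ĵ = suc (toℕ j)
          exponents : ∀ g m k j i a → g N.* (m N.* k N.+ j N.* i) N.+ j N.* a ≡ m N.* (g N.* k) N.+ j N.* (g N.* i N.+ a)
          exponents = +-*-Solver.solve 6 (λ g m k j i a →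
            g +-*-Solver.:* (m +-*-Solver.:* k +-*-Solver.:+ j +-*-Solver.:* i) +-*-Solver.:+ j +-*-Solver.:* a
            +-*-Solver.:= m +-*-Solver.:* (g +-*-Solver.:* k) +-*-Solver.:+ j +-*-Solver.:* (g +-*-Solver.:* i +-*-Solver.:+ a)) ≡-refl

      column-sum-value : ∀ m a p k → gcd k (suc p) ≡ 1 → x ∣ x / suc p N.* inv p k N.+ a →
        column-sum m a p k ≈ X * pow ζ (m N.* (x / suc p N.* k))
      column-sum-value m a p k k⊥q x∣ = trans (column-sum-coprime m a p k k⊥q)
        (trans (*-congˡ (orthogonal-∣ _ x∣)) (*-comm _ _))

      column-sum-zero : ∀ m a p k → ¬ (gcd k (suc p) ≡ 1 × x ∣ x / suc p N.* inv p k N.+ a) →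
        column-sum m a p k ≈ 0#
      column-sum-zero m a p k no-congruence with gcd k (suc p) N.≟ 1
      ... | yes k⊥q = trans (column-sum-coprime m a p k k⊥q)
        (trans (*-congˡ (orthogonal-∤ _ (λ x∣ → no-congruence (k⊥q , x∣)))) (zeroʳ _))
      ... | no k⊥̸q = sumFin-zero x (λ j → trans
        (*-congʳ (reflexive (≡-cong (if_then pow ζ (x / suc p N.* (m N.* k N.+ suc (toℕ j) N.* inv p k)) else 0#) (dec-false (gcd k (suc p) N.≟ 1) k⊥̸q)))) (zeroˡ _))

      x/-unique : ∀ {g} p → g N.* suc p ≡ x → x / suc p ≡ g
      x/-unique {g} p gq≡x = ≡-trans (≡-cong (_/ suc p) (≡-sym gq≡x)) (m*n/n≡m g (suc p))

      x/-cancel : ∀ p → suc p ≤ Q → x / suc p N.* suc p ≡ x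
      x/-cancel p q≤Q with divides g x≡gq ← ∣x (suc p) (s≤s z≤n) q≤Q =
        ≡-trans (≡-cong (N._* suc p) (x/-unique {g} p (≡-sym x≡gq))) (≡-sym x≡gq)

      Y : Matrix x x
      Y = Ymat ζ Q x

      module _ (i e : Fin x) where
        private
          m a : ℕ
          m = suc (toℕ i)
          a = suc (toℕ e)

        q-sum : ℕ → Carrier
        q-sum q = sumFin x (λ j → kloosterman ζ x m (suc (toℕ j)) (q ∸ 1) * fourier j e)

        Y-fourier-sum : (Y · fourier) i e ≈ sumR Q q-sum
        Y-fourier-sum = sumFin-sumR x Q (λ j q → kloosterman ζ x m (suc (toℕ j)) (q ∸ 1)) (λ j → fourier j e)

        q-sum-expand : ∀ p → q-sum (suc p) ≈ sumR (suc p) (column-sum m a p)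
        q-sum-expand p = sumFin-sumR x (suc p) (λ j k → coprime-term m (suc (toℕ j)) p k) (λ j → fourier j e)

        -- A non-zero term of the double sum over `q` and `k` would exhibit a partner of `a`.
        Y-fourier-nonfarey : farey a ≡ false → (Y · fourier) i e ≈ 0#
        Y-fourier-nonfarey fa = trans Y-fourier-sum (sumR-zero Q (λ
          { (suc p) _ q≤Q → trans (q-sum-expand p) (sumR-zero (suc p) (λ k 1≤k k≤q → column-sum-zero m a p k (λ (k⊥q , x∣) →
              let P , _ = congruence⇒Partner (x / suc p) p k q≤Q (x/-cancel p q≤Q) k⊥q x∣
                  instance _ = Partner.g≢0 P
                  1≤b , b≤x = scaled-bounds (x / suc p) (suc p) k (x/-cancel p q≤Q) 1≤k k≤q
              in case-false (≡-trans (≡-sym fa) (proj₁ (farey-true P 1≤b b≤x)))))) }))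
          where
          case-false : false ≡ true → ⊥
          case-false ()

        -- A surviving term `(q, k)` makes `(x / q) * k` a partner of `a`. Denominators and partners
        -- are unique, so exactly one term remains, the one belonging to `τ a`.
        Y-fourier-farey : farey a ≡ true → (Y · fourier) i e ≈ X * pow ζ (m N.* τ a)
        Y-fourier-farey fa = with-partner (proj₂ (proj₂ spec))
          where
          spec = farey⇒Partner a fa
          with-partner : Partner a (τ a) → (Y · fourier) i e ≈ X * pow ζ (m N.* τ a)
          with-partner (partner g zero k l q≤Q gq≡x a≡gk b≡gl q∣) =
            ⊥-elim (N.≢-nonZero⁻¹ x (≡-trans (≡-sym gq≡x) (N.*-zeroʳ g)))
          with-partner P₀@(partner g (suc p) k₀ l q≤Q gq≡x a≡gk b≡gl q∣) = begin
            (Y · fourier) i e                 ≈⟨ Y-fourier-sum ⟩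
            sumR Q q-sum                      ≈⟨ sumR-single Q (suc p) (s≤s z≤n) q≤Q other-q ⟩
            q-sum (suc p)                     ≈⟨ q-sum-expand p ⟩
            sumR (suc p) (column-sum m a p)   ≈⟨ sumR-single (suc p) l (proj₁ l-bounds) (proj₂ l-bounds) other-k ⟩
            column-sum m a p l                ≈⟨ column-sum-value m a p l (proj₁ congruence) (proj₂ congruence) ⟩
            X * pow ζ (m N.* (x / suc p N.* l)) ≈⟨ *-congˡ (reflexive (≡-cong (λ b → pow ζ (m N.* b)) (≡-trans (≡-cong (N._* l) g≡) (≡-sym b≡gl)))) ⟩
            X * pow ζ (m N.* τ a)             ∎
            where
            instance
              g≢0 : NonZero g
              g≢0 = Partner.g≢0 P₀
            g≡ : x / suc p ≡ g
            g≡ = x/-unique p gq≡x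
            l-bounds : 1 ≤ l × l ≤ suc p
            l-bounds = bounds-cancel g (suc p) l gq≡x b≡gl (proj₁ spec) (proj₁ (proj₂ spec))
            congruence : gcd l (suc p) ≡ 1 × x ∣ x / suc p N.* inv p l N.+ a
            congruence = Partner⇒congruence (x / suc p) p l k₀ (x/-cancel p q≤Q) (≡-trans a≡gk (≡-cong (N._* k₀) (≡-sym g≡))) q∣
            other-q : ∀ q → 1 ≤ q → q ≤ Q → q ≢ suc p → q-sum q ≈ 0#
            other-q (suc p′) _ q′≤Q q′≢q = trans (q-sum-expand p′) (sumR-zero (suc p′) (λ k _ _ →
              column-sum-zero m a p′ k (λ (k⊥q , x∣) →
                let P , q≡ = congruence⇒Partner (x / suc p′) p′ k q′≤Q (x/-cancel p′ q′≤Q) k⊥q x∣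
                in q′≢q (≡-trans (≡-sym q≡) (Partner-q-unique P P₀)))))
            other-k : ∀ k → 1 ≤ k → k ≤ suc p → k ≢ l → column-sum m a p k ≈ 0#
            other-k k 1≤k k≤q k≢l = column-sum-zero m a p k (λ (k⊥q , x∣) →
              let P , _ = congruence⇒Partner (x / suc p) p k q≤Q (x/-cancel p q≤Q) k⊥q x∣
                  1≤b , b≤x = scaled-bounds (x / suc p) (suc p) k {{Partner.g≢0 P}} (x/-cancel p q≤Q) 1≤k k≤q
                  gk≡b = Partner-unique P P₀ 1≤b b≤x (proj₁ spec) (proj₁ (proj₂ spec))
              in k≢l (N.*-cancelˡ-≡ k l g (≡-trans (≡-cong (N._* k) (≡-sym g≡)) (≡-trans gk≡b b≡gl))))

      -- The index `e` stands for the exponent `suc (toℕ e)`; going back by `pred` is faithful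
      -- because `τ` takes values from 1 on.
      τ-index : ∀ e → N.pred (τ (suc (toℕ {x} e))) < x
      τ-index e with τ (suc (toℕ e)) | τ-bounds (suc (toℕ e)) (s≤s z≤n) (toℕ<n e)
      ... | suc b | _ , b<x = b<x

      τᶠ : Fin x → Fin x
      τᶠ e = fromℕ< (τ-index e)

      suc-toℕ-τᶠ : ∀ e → suc (toℕ (τᶠ e)) ≡ τ (suc (toℕ e))
      suc-toℕ-τᶠ e = ≡-trans (≡-cong suc (toℕ-fromℕ< (τ-index e)))
        (N.suc-pred (τ (suc (toℕ e))) {{N.>-nonZero (proj₁ (τ-bounds (suc (toℕ e)) (s≤s z≤n) (toℕ<n e)))}})

      τᶠ-involutive : ∀ e → τᶠ (τᶠ e) ≡ e
      τᶠ-involutive e = toℕ-injective (N.suc-injective (≡-trans (suc-toℕ-τᶠ (τᶠ e))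
        (≡-trans (≡-cong τ (suc-toℕ-τᶠ e)) (proj₂ (τ-involutive (suc (toℕ e)) (s≤s z≤n) (toℕ<n e))))))

      fareyᶠ : Fin x → Bool
      fareyᶠ e = farey (suc (toℕ e))

      fareyᶠ-τᶠ : ∀ e → fareyᶠ (τᶠ e) ≡ fareyᶠ e
      fareyᶠ-τᶠ e = ≡-trans (≡-cong farey (suc-toℕ-τᶠ e)) (proj₁ (τ-involutive (suc (toℕ e)) (s≤s z≤n) (toℕ<n e)))

      -- Weight 0 on the remaining indices, which `τᶠ` fixes, puts the kernel of `Y` into the same
      -- weighted involution: such an index is a fixed point contributing `t`.
      σ : Fin x → Carrier
      σ e = if fareyᶠ e then X else 0#

      σ-τᶠ : ∀ e → σ (τᶠ e) ≈ σ e
      σ-τᶠ e = reflexive (≡-cong (if_then X else 0#) (fareyᶠ-τᶠ e))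

      Y-fourier : ∀ i e → (Y · fourier) i e ≈ σ e * fourier i (τᶠ e)
      Y-fourier i e = by-cases (farey (suc (toℕ e))) ≡-refl
        where
        by-cases : ∀ b → farey (suc (toℕ e)) ≡ b → (Y · fourier) i e ≈ (if b then X else 0#) * fourier i (τᶠ e)
        by-cases true  fa = trans (Y-fourier-farey i e fa)
          (*-congˡ (reflexive (≡-cong (λ b → pow ζ (suc (toℕ i) N.* b)) (≡-sym (suc-toℕ-τᶠ e)))))
        by-cases false fa = trans (Y-fourier-nonfarey i e fa) (sym (zeroˡ _))

      -- The permutation matrix of an involution is symmetric.
      δ-τᶠ : ∀ j e → δ (τᶠ j) e ≈ δ j (τᶠ e)
      δ-τᶠ j e with j ≟ τᶠ e
      ... | yes ≡-refl = trans (trans (reflexive (≡-cong (λ r → δ r e) (τᶠ-involutive e))) (δ-diag e)) (sym (δ-diag j))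
      ... | no j≢ = trans (δ-off (λ τj≡e → j≢ (≡-trans (≡-sym (τᶠ-involutive j)) (≡-cong τᶠ τj≡e)))) (sym (δ-off j≢))

      -- Conjugation by the Fourier matrix

      module _ (t : Carrier) where
        open Involution τᶠ τᶠ-involutive σ σ-τᶠ t

        tE-Y : Matrix x x
        tE-Y i j = t * idMat x i j - Y i j

        tE-Y-fourier : ∀ i e → (tE-Y · fourier) i e ≈ t * fourier i e + - (σ e * fourier i (τᶠ e))
        tE-Y-fourier i e = begin
          sumFin x (λ j → (t * idMat x i j - Y i j) * fourier j e)
            ≈⟨ sumFin-cong x (λ j → trans (distribʳ _ _ _) (+-cong
                 (trans (*-congʳ (*-congˡ (idMat≈δ x i j))) (*-assoc _ _ _))
                 (trans (*-congʳ (sym (-1*x≈-x _))) (*-assoc _ _ _)))) ⟩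
          sumFin x (λ j → t * (δ i j * fourier j e) + - 1# * (Y i j * fourier j e))
            ≈⟨ sumFin-+ x _ _ ⟩
          sumFin x (λ j → t * (δ i j * fourier j e)) + sumFin x (λ j → - 1# * (Y i j * fourier j e))
            ≈⟨ sym (+-cong (*-sumFin x t _) (*-sumFin x (- 1#) _)) ⟩
          t * sumFin x (λ j → δ i j * fourier j e) + - 1# * (Y · fourier) i e
            ≈⟨ +-cong (*-congˡ (δ-sumˡ i (λ j → fourier j e))) (trans (-1*x≈-x _) (-‿cong (Y-fourier i e))) ⟩
          t * fourier i e + - (σ e * fourier i (τᶠ e)) ∎

        fourier-twisted : ∀ i e → (fourier · twisted) i e ≈ t * fourier i e + - (σ e * fourier i (τᶠ e))
        fourier-twisted i e = begin
          sumFin x (λ j → fourier i j * (t * δ j e + - σ j * δ (τᶠ j) e))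
            ≈⟨ sumFin-cong x (λ j → trans (*-congˡ (+-congˡ (*-congˡ (δ-τᶠ j e))))
                 (solve 5 (λ f t d n d′ → f :* (t :* d :+ n :* d′) := t :* (f :* d) :+ (n :* f) :* d′) refl _ _ _ _ _)) ⟩
          sumFin x (λ j → t * (fourier i j * δ j e) + - σ j * fourier i j * δ j (τᶠ e))
            ≈⟨ sumFin-+ x _ _ ⟩
          sumFin x (λ j → t * (fourier i j * δ j e)) + sumFin x (λ j → - σ j * fourier i j * δ j (τᶠ e))
            ≈⟨ +-cong (trans (sym (*-sumFin x t _)) (*-congˡ (δ-sumʳ e (fourier i)))) (δ-sumʳ (τᶠ e) (λ j → - σ j * fourier i j)) ⟩
          t * fourier i e + - σ (τᶠ e) * fourier i (τᶠ e)
            ≈⟨ +-congˡ (trans (*-congʳ (-‿cong (σ-τᶠ e))) (sym (-‿distribˡ-* _ _))) ⟩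
          t * fourier i e + - (σ e * fourier i (τᶠ e)) ∎

        det-tE-Y : det x tE-Y ≈ prodFin x weight
        det-tE-Y = trans (*-cancelʳ det-fourier≉0 (begin
          det x tE-Y * det x fourier     ≈⟨ sym (det-· x tE-Y fourier) ⟩
          det x (tE-Y · fourier)         ≈⟨ det-cong x (λ i e → trans (tE-Y-fourier i e) (sym (fourier-twisted i e))) ⟩
          det x (fourier · twisted)      ≈⟨ det-· x fourier twisted ⟩
          det x fourier * det x twisted  ≈⟨ *-comm _ _ ⟩
          det x twisted * det x fourier  ∎)) det-twisted

-- Counting

indicator : Bool → ℕ
indicator b = if b then 1 else 0

true-or-false : ∀ b → (b ≡ true) ⊎ (b ≡ false)
true-or-false true  = inj₁ ≡-refl
true-or-false false = inj₂ ≡-refl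

countUpTo-suc : ∀ n P → countUpTo (suc n) P ≡ indicator (P 1) N.+ countUpTo n (P ∘ suc)
countUpTo-suc zero    P = ≡-refl
countUpTo-suc (suc n) P = ≡-trans (≡-cong (indicator (P (suc (suc n))) N.+_) (countUpTo-suc n P))
  (solve 3 (λ a b c → a :+ (b :+ c) := b :+ (a :+ c))
        ≡-refl (indicator (P (suc (suc n)))) (indicator (P 1)) (countUpTo n (P ∘ suc)))
  where open +-*-Solver

sum-indicator : ∀ n P → sum {n} (λ e → indicator (P (suc (toℕ e)))) ≡ countUpTo n P
sum-indicator zero    P = ≡-refl
sum-indicator (suc n) P = ≡-trans (≡-cong (indicator (P 1) N.+_) (sum-indicator n (P ∘ suc))) (≡-sym (countUpTo-suc n P))

sum-one : ∀ n (f : Fin n → ℕ) → (∀ e → f e ≡ 1) → sum f ≡ n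
sum-one zero    f f≡1 = ≡-refl
sum-one (suc n) f f≡1 = ≡-cong₂ N._+_ (f≡1 zero) (sum-one n (f ∘ suc) (f≡1 ∘ suc))

-- Reindexing by `τ` turns `e < τ e` into `τ e < e`.
ascents≡descents : ∀ {n} (τ : Fin n → Fin n) → (∀ e → τ (τ e) ≡ e) →
  sum (λ e → indicator (does (e F.<? τ e))) ≡ sum (λ e → indicator (does (τ e F.<? e)))
ascents≡descents τ ττ = ≡-trans
  (sum-permute (λ e → indicator (does (e F.<? τ e))) (permutation τ τ ττ ττ))
  (sum-cong-≗ (λ e → ≡-cong (λ r → indicator (does (τ e F.<? r))) (ττ e)))

module Product {c ℓ : Level} (R : CommutativeRing c ℓ) where
  open CommutativeRing R hiding (zero)
  open RingDefs R
  open Determinant R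
  open PowersAndSums R
  open import Algebra.Properties.CommutativeSemigroup *-commutativeSemigroup using (interchange)

  prodFin-pow : ∀ n (w : Row n) a b d (k l m : Fin n → ℕ) →
    (∀ e → w e ≈ pow a (k e) * (pow b (l e) * pow d (m e))) →
    prodFin n w ≈ pow a (sum k) * (pow b (sum l) * pow d (sum m))
  prodFin-pow zero    w a b d k l m w≈ = sym (trans (*-identityˡ _) (*-identityˡ _))
  prodFin-pow (suc n) w a b d k l m w≈ = trans
    (*-cong (w≈ zero) (prodFin-pow n (w ∘ suc) a b d (k ∘ suc) (l ∘ suc) (m ∘ suc) (w≈ ∘ suc)))
    (trans (interchange _ _ _ _) (*-cong (sym (pow-+ a (k zero) _))
      (trans (interchange _ _ _ _) (*-cong (sym (pow-+ b (l zero) _)) (sym (pow-+ d (m zero) _))))))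

-- Exponents of the characteristic polynomial

module Assembly {c ℓ : Level} (R : CommutativeRing c ℓ)
  (1≉0 : PowersAndSums.Nontrivial R) (domain : PowersAndSums.NoZeroDivisors R)
  (Q x : ℕ) {{x≢0 : NonZero x}} (∣x : ∀ q → 1 ≤ q → q ≤ Q → q ∣ x)
  (ζ : CommutativeRing.Carrier R) where
  open CommutativeRing R hiding (zero)
  open RingDefs R
  open Determinant R
  open PowersAndSums R
  open Domain R 1≉0 domain
  open Product R
  open import Algebra.Properties.Ring ring using (-0#≈0#)
  open Farey Q x

  module _ (ζˣ≈1 : pow ζ x ≈ 1#) (order≥x : ∀ d → 0 < d → d < x → ¬ (pow ζ d ≈ 1#)) (t : Carrier) where
    open PrimitiveRoot x ζ ζˣ≈1 order≥x
    open Kloosterman Q ∣x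
    open Involution τᶠ τᶠ-involutive σ σ-τᶠ t using (weight; weight->; weight-≯)

    fixes ascends descends : Fin x → ℕ
    fixes e    = indicator (fixed (suc (toℕ e)))
    ascends e  = indicator (does (e F.<? τᶠ e))
    descends e = indicator (does (τᶠ e F.<? e))

    ¬farey⇒fixedᶠ : ∀ e → fareyᶠ e ≡ false → τᶠ e ≡ e
    ¬farey⇒fixedᶠ e fa = toℕ-injective (N.suc-injective (≡-trans (suc-toℕ-τᶠ e) (¬farey⇒τ≡ (suc (toℕ e)) fa)))

    fixes-≡ : ∀ e → fareyᶠ e ≡ true → τᶠ e ≡ e → fixes e ≡ 1
    fixes-≡ e fa τe≡e = ≡-cong₂ (λ f b → indicator (f ∧ b)) fa
      (dec-true (τ (suc (toℕ e)) N.≟ suc (toℕ e)) (≡-trans (≡-sym (suc-toℕ-τᶠ e)) (≡-cong (suc ∘ toℕ) τe≡e)))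

    fixes-≢ : ∀ e → fareyᶠ e ≡ true → τᶠ e ≢ e → fixes e ≡ 0
    fixes-≢ e fa τe≢e = ≡-cong₂ (λ f b → indicator (f ∧ b)) fa
      (dec-false (τ (suc (toℕ e)) N.≟ suc (toℕ e))
        (λ τe≡e → τe≢e (toℕ-injective (N.suc-injective (≡-trans (suc-toℕ-τᶠ e) τe≡e)))))

    fixes-nonfarey : ∀ e → fareyᶠ e ≡ false → fixes e ≡ 0
    fixes-nonfarey e fa = ≡-cong (λ f → indicator (f ∧ (τ (suc (toℕ e)) N.≡ᵇ suc (toℕ e)))) fa

    -- A table row for one index, so that the counting identity and the product formula rest on the
    -- same case distinction.
    record Kind (e : Fin x) (inFarey : Bool) (fix asc desc : ℕ) (w : Carrier) : Set ℓ where
      constructor kind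
      field
        farey≡    : fareyᶠ e ≡ inFarey
        fixes≡    : fixes e ≡ fix
        ascends≡  : ascends e ≡ asc
        descends≡ : descends e ≡ desc
        weight≈   : weight e ≈ w

    σ-farey : ∀ e → fareyᶠ e ≡ true → σ e ≈ X
    σ-farey e fa = reflexive (≡-cong (if_then X else 0#) fa)

    τᶠ≢⇒farey : ∀ e → τᶠ e ≢ e → fareyᶠ e ≡ true
    τᶠ≢⇒farey e τe≢e with true-or-false (fareyᶠ e)
    ... | inj₁ fa = fa
    ... | inj₂ fa = ⊥-elim (τe≢e (¬farey⇒fixedᶠ e fa))

    -- The cases are: outside the Farey exponents, fixed Farey exponent, smaller and larger element
    -- of a two-cycle. An index moved by `τᶠ` is always Farey.
    classify : ∀ e → Kind e false 0 0 0 t ⊎ Kind e true 1 0 0 (t - X) ⊎ Kind e true 0 1 0 (t - X) ⊎ Kind e true 0 0 1 (t + X)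
    classify e with <-cmp e (τᶠ e) | true-or-false (fareyᶠ e)
    ... | tri< e<τe e≢τe τe≮e | _ = inj₂ (inj₂ (inj₁ (kind (τᶠ≢⇒farey e (≢-sym e≢τe)) (fixes-≢ e (τᶠ≢⇒farey e (≢-sym e≢τe)) (≢-sym e≢τe))
      (≡-cong indicator (dec-true (e F.<? τᶠ e) e<τe)) (≡-cong indicator (dec-false (τᶠ e F.<? e) τe≮e))
      (trans (weight-≯ τe≮e) (+-congˡ (-‿cong (σ-farey e (τᶠ≢⇒farey e (≢-sym e≢τe)))))))))
    ... | tri> e≮τe e≢τe τe<e | _ = inj₂ (inj₂ (inj₂ (kind (τᶠ≢⇒farey e (≢-sym e≢τe)) (fixes-≢ e (τᶠ≢⇒farey e (≢-sym e≢τe)) (≢-sym e≢τe))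
      (≡-cong indicator (dec-false (e F.<? τᶠ e) e≮τe)) (≡-cong indicator (dec-true (τᶠ e F.<? e) τe<e))
      (trans (weight-> τe<e) (+-congˡ (σ-farey e (τᶠ≢⇒farey e (≢-sym e≢τe))))))))
    ... | tri≈ e≮τe e≡τe τe≮e | inj₁ fa = inj₂ (inj₁ (kind fa (fixes-≡ e fa (≡-sym e≡τe))
      (≡-cong indicator (dec-false (e F.<? τᶠ e) e≮τe)) (≡-cong indicator (dec-false (τᶠ e F.<? e) τe≮e))
      (trans (weight-≯ τe≮e) (+-congˡ (-‿cong (σ-farey e fa))))))
    ... | tri≈ e≮τe e≡τe τe≮e | inj₂ fa = inj₁ (kind fa (fixes-nonfarey e fa)
      (≡-cong indicator (dec-false (e F.<? τᶠ e) e≮τe)) (≡-cong indicator (dec-false (τᶠ e F.<? e) τe≮e))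
      (trans (weight-≯ τe≮e) (trans (+-congˡ (trans (-‿cong (reflexive (≡-cong (if_then X else 0#) fa))) -0#≈0#)) (+-identityʳ t))))

    Kind-split : ∀ {e f p a d w} → Kind e f p a d w → indicator f ≡ p N.+ a N.+ d →
      indicator (fareyᶠ e) ≡ fixes e N.+ ascends e N.+ descends e
    Kind-split (kind ≡-refl ≡-refl ≡-refl ≡-refl _) eq = eq

    farey-split : ∀ e → indicator (fareyᶠ e) ≡ fixes e N.+ ascends e N.+ descends e
    farey-split e with classify e
    ... | inj₁ k               = Kind-split k ≡-refl
    ... | inj₂ (inj₁ k)        = Kind-split k ≡-refl
    ... | inj₂ (inj₂ (inj₁ k)) = Kind-split k ≡-refl
    ... | inj₂ (inj₂ (inj₂ k)) = Kind-split k ≡-refl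

    powers : ℕ → ℕ → ℕ → Carrier
    powers k l m = pow t k * (pow (t - X) l * pow (t + X) m)

    outside : Fin x → ℕ
    outside e = indicator (not (fareyᶠ e))

    Kind-weight : ∀ {e f p a d w} → Kind e f p a d w → w ≈ powers (indicator (not f)) (p N.+ a) d →
      weight e ≈ powers (outside e) (fixes e N.+ ascends e) (descends e)
    Kind-weight (kind ≡-refl ≡-refl ≡-refl ≡-refl w) eq = trans w eq

    weight-powers : ∀ e → weight e ≈ powers (outside e) (fixes e N.+ ascends e) (descends e)
    weight-powers e with classify e
    ... | inj₁ k               = Kind-weight k (sym (trans (*-cong (*-identityʳ _) (*-identityˡ _)) (*-identityʳ _)))
    ... | inj₂ (inj₁ k)        = Kind-weight k (sym (trans (*-identityˡ _) (trans (*-identityʳ _) (*-identityʳ _))))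
    ... | inj₂ (inj₂ (inj₁ k)) = Kind-weight k (sym (trans (*-identityˡ _) (trans (*-identityʳ _) (*-identityʳ _))))
    ... | inj₂ (inj₂ (inj₂ k)) = Kind-weight k (sym (trans (*-identityˡ _) (trans (*-identityˡ _) (*-identityʳ _))))

    Φ̃≡ : sum fixes ≡ Φ̃ Q
    Φ̃≡ = ≡-trans (sum-indicator x fixed) (count-fixed ∣x)

    ascents≡ : sum ascends ≡ sum descends
    ascents≡ = ascents≡descents τᶠ τᶠ-involutive

    -- Each two-cycle has one smaller and one larger element, so `Φ Q` exceeds `Φ̃ Q` by an even
    -- number, and the divisions by 2 in the exponents are exact.
    Φ≡ : Φ Q ≡ Φ̃ Q N.+ sum descends N.* 2
    Φ≡ = begin
      Φ Q                                              ≡⟨ ≡-sym (≡-trans (sum-indicator x farey) (count-farey ∣x)) ⟩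
      sum (λ e → indicator (fareyᶠ e))                 ≡⟨ sum-cong-≗ farey-split ⟩
      sum (λ e → fixes e N.+ ascends e N.+ descends e) ≡⟨ ∑-distrib-+ (λ e → fixes e N.+ ascends e) descends ⟩
      sum (λ e → fixes e N.+ ascends e) N.+ sum descends ≡⟨ ≡-cong (N._+ sum descends) (∑-distrib-+ fixes ascends) ⟩
      sum fixes N.+ sum ascends N.+ sum descends       ≡⟨ ≡-cong₂ (λ f a → f N.+ a N.+ sum descends) Φ̃≡ ascents≡ ⟩
      Φ̃ Q N.+ sum descends N.+ sum descends            ≡⟨ solve 2 (λ f d → f :+ d :+ d := f :+ d :* con 2)
            ≡-refl (Φ̃ Q) (sum descends) ⟩
      Φ̃ Q N.+ sum descends N.* 2                       ∎
      where
      open ≡-Reasoning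
      open +-*-Solver

    -- The Farey exponents are among 1,...,x, so the truncated subtraction loses nothing and counts
    -- the others.
    outside≡ : x ∸ Φ Q ≡ sum outside
    outside≡ = begin
      x ∸ Φ Q                           ≡⟨ ≡-cong₂ _∸_ (≡-sym total) (≡-sym (≡-trans (sum-indicator x farey) (count-farey ∣x))) ⟩
      sum outside N.+ fareys ∸ fareys   ≡⟨ N.m+n∸n≡m (sum outside) fareys ⟩
      sum outside                       ∎
      where
      open ≡-Reasoning
      fareys = sum (λ e → indicator (fareyᶠ e))
      complement : ∀ b → indicator (not b) N.+ indicator b ≡ 1
      complement true  = ≡-refl
      complement false = ≡-refl
      total : sum outside N.+ fareys ≡ x
      total = ≡-trans (≡-sym (∑-distrib-+ outside (λ e → indicator (fareyᶠ e))))
        (sum-one x _ (λ e → complement (fareyᶠ e)))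

    -- With `d` two-cycles, `Φ Q + Φ̃ Q` is twice `Φ̃ Q + d`: the factor `t - X` comes once from
    -- each fixed point and once from each two-cycle.
    plus≡ : (Φ Q N.+ Φ̃ Q) / 2 ≡ sum (λ e → fixes e N.+ ascends e)
    plus≡ = begin
      (Φ Q N.+ Φ̃ Q) / 2                        ≡⟨ ≡-cong (λ n → (n N.+ Φ̃ Q) / 2) Φ≡ ⟩
      (Φ̃ Q N.+ sum descends N.* 2 N.+ Φ̃ Q) / 2 ≡⟨ ≡-cong (_/ 2) (solve 2 (λ f d → f :+ d :* con 2 :+ f := (f :+ d) :* con 2)
            ≡-refl (Φ̃ Q) (sum descends)) ⟩
      (Φ̃ Q N.+ sum descends) N.* 2 / 2         ≡⟨ m*n/n≡m (Φ̃ Q N.+ sum descends) 2 ⟩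
      Φ̃ Q N.+ sum descends                     ≡⟨ ≡-cong₂ N._+_ (≡-sym Φ̃≡) (≡-sym ascents≡) ⟩
      sum fixes N.+ sum ascends                ≡⟨ ≡-sym (∑-distrib-+ fixes ascends) ⟩
      sum (λ e → fixes e N.+ ascends e)        ∎
      where
      open ≡-Reasoning
      open +-*-Solver

    minus≡ : (Φ Q ∸ Φ̃ Q) / 2 ≡ sum descends
    minus≡ = ≡-trans (≡-cong (_/ 2) (≡-trans (≡-cong (_∸ Φ̃ Q) Φ≡) (N.m+n∸m≡n (Φ̃ Q) _))) (m*n/n≡m (sum descends) 2)

    charpoly : det x (λ i j → t * idMat x i j - Ymat ζ Q x i j) ≈
      pow t (x ∸ Φ Q) * (pow (t - fromℕ x) ((Φ Q N.+ Φ̃ Q) / 2) * pow (t + fromℕ x) ((Φ Q ∸ Φ̃ Q) / 2))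
    charpoly = trans (det-tE-Y t) (trans
      (prodFin-pow x weight t (t - X) (t + X) outside (λ e → fixes e N.+ ascends e) descends weight-powers)
      (*-cong (reflexive (≡-cong (pow t) (≡-sym outside≡)))
        (*-cong (reflexive (≡-cong (pow (t - X)) (≡-sym plus≡))) (reflexive (≡-cong (pow (t + X)) (≡-sym minus≡))))))

theorem4 : {c ℓ : Level} (R : CommutativeRing c ℓ) →
    let open CommutativeRing R in
    let open RingDefs R in
    ¬ (1# ≈ 0#) →
    (∀ a b → a * b ≈ 0# → (a ≈ 0#) ⊎ (b ≈ 0#)) →
    (Q : ℕ) → 1 ≤ Q →
    (ζ : Carrier) →
    pow ζ (lcmUpTo Q) ≈ 1# →
    (∀ d → 0 < d → d < lcmUpTo Q → ¬ (pow ζ d ≈ 1#)) →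
    (t : Carrier) →
    det (lcmUpTo Q)
    (λ i j → t * idMat (lcmUpTo Q) i j - Ymat ζ Q (lcmUpTo Q) i j)
    ≈ pow t (lcmUpTo Q ∸ Φ Q)
    * (pow (t - fromℕ (lcmUpTo Q)) ((Φ Q N.+ Φ̃ Q) / 2)
    * pow (t + fromℕ (lcmUpTo Q)) ((Φ Q ∸ Φ̃ Q) / 2))
theorem4 R 1≉0 domain Q _ ζ ζˣ≈1 order≥x t =
  Assembly.charpoly R 1≉0 domain Q (lcmUpTo Q) {{N.≢-nonZero (lcmUpTo≢0 Q)}} (∣lcmUpTo Q) ζ ζˣ≈1 order≥x t
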